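{- Let $X_3=\mathrm{Cay}(\mathfrak S_4,\{(1,4),(2,4),(3,4)\})$. The spectrum $\mathcal S$ of $X_3$ is given, as a multiset, by \[ \mathcal S=\left\{\pm\left|1+\exp\left(\frac{2\pi k i}{6}\right)+\exp\left(\frac{2\pi(-k+3l)i}{6}\right)\right|\ \middle|\ k\in\mathbb Z/6\mathbb Z,\ l\in\mathbb Z/2\mathbb Z\right\}, \] where $i=\sqrt{ -1}$.
   Context: The spectrum of a finite graph is the multiset of eigenvalues (with multiplicity) of its adjacency matrix. The right-hand side is a multiset with 24 elements: each pair $(k,l)$ contributes two elements, one with each sign (so a value $0$ is counted twice). $\mathrm{Cay}(G,S)$ is the simple undirected graph with vertex set $G$ in which $\xi,\eta$ are adjacent iff $\eta=\xi s$ for some $s\in S$; $\mathfrak S_4$ is the symmetric group on $\{1,2,3,4\}$ and $(a,b)$ denotes a transposition. -}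

module Defs where

open import Level using (_⊔_; 0ℓ) renaming (suc to lsuc)
open import Algebra.Bundles using (Group; CommutativeRing)
open import Algebra.Apartness.Bundles using (HeytingField; HeytingCommutativeRing)
open import Algebra.Apartness.Properties.HeytingCommutativeRing using (1#0; x-0≈x)
open import Data.Bool.Base using (if_then_else_)
open import Data.Fin.Base using (Fin; zero; suc; toℕ; punchIn; combine; remQuot)
open import Data.Fin.Patterns using (0F; 1F; 2F; 3F)
open import Data.Fin.Permutation as Perm
  using (Permutation′; _⟨$⟩ʳ_; _⟨$⟩ˡ_; _∘ₚ_; transpose; insert; remove; insert-punchIn; insert-remove)
import Data.Fin.Properties as Fin
open import Data.Integer.Base as ℤ using (ℤ; +_; -[1+_])
open import Data.List.Base as List using (List; []; _∷_)
open import Data.List.Relation.Unary.All as All using (All)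
open import Data.List.Relation.Unary.Any as Any using (Any)
open import Data.Nat.Base as ℕ using (ℕ; zero; suc; _!; NonZero)
import Data.Nat.Properties as ℕ
open import Data.Product.Base using (∃-syntax; _×_; _,_; proj₁; proj₂)
open import Data.Sum.Base using (_⊎_; inj₁; inj₂)
open import Function.Base using (_∘_)
open import Function.Bundles using (Bijection)
open import Relation.Binary.Bundles using (Setoid)
open import Relation.Binary.Core using (Rel)
open import Relation.Binary.Definitions using (Decidable; Symmetric; Irreflexive; _Respects₂_)
open import Relation.Binary.PropositionalEquality as ≡ using (_≡_; refl; cong; cong₂)
open import Relation.Binary.Structures using (IsStrictPartialOrder)
open import Relation.Nullary.Decidable using (does; from-yes; ¬?)
open import Relation.Nullary.Negation using (¬_)

------------------------------------------------------------------------
-- Real numbers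

module Convergence {c ℓ₁ ℓ₂ ℓ₃} (F : HeytingField c ℓ₁ ℓ₂)
                   (_<_ : Rel (HeytingField.Carrier F) ℓ₃) where
  open HeytingField F
  open import Algebra.Definitions.RawMonoid
    (CommutativeRing.+-rawMonoid (HeytingCommutativeRing.commutativeRing heytingCommutativeRing))
    using () renaming (_×_ to _·_)

  fromℕ : ℕ → Carrier
  fromℕ n = n · 1#

  Within : Carrier → Rel Carrier ℓ₃
  Within ε x y = (x - y) < ε × (y - x) < ε

  Cauchy : (ℕ → Carrier) → Set (c ⊔ ℓ₃)
  Cauchy s = ∀ ε → 0# < ε →
    ∃[ N ] (∀ m n → N ℕ.≤ m → N ℕ.≤ n → Within ε (s m) (s n))

  infix 4 _⟶_
  _⟶_ : (ℕ → Carrier) → Carrier → Set (c ⊔ ℓ₃)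
  s ⟶ x = ∀ ε → 0# < ε → ∃[ N ] (∀ n → N ℕ.≤ n → Within ε (s n) x)

-- A Cauchy-complete Archimedean ordered field.  No decidability of the
-- order is assumed, so that the axioms hold for the classical reals as
-- well as for constructive (Cauchy or Dedekind) reals.

record RealNumbers c ℓ₁ ℓ₂ ℓ₃ : Set (lsuc (c ⊔ ℓ₁ ⊔ ℓ₂ ⊔ ℓ₃)) where
  infix 4 _<_
  field
    heytingField : HeytingField c ℓ₁ ℓ₂

  open HeytingField heytingField public

  field
    _<_ : Rel Carrier ℓ₃

  open Convergence heytingField _<_ public

  field
    isStrictPartialOrder : IsStrictPartialOrder _≈_ _<_
    #⇒<                  : ∀ {x y} → x # y → x < y ⊎ y < x
    <⇒#                  : ∀ {x y} → x < y → x # y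
    +-monoˡ-<            : ∀ z {x y} → x < y → x + z < y + z
    *-pos                : ∀ {x y} → 0# < x → 0# < y → 0# < x * y
    archimedean          : ∀ x → ∃[ n ] x < fromℕ n
    complete             : ∀ s → Cauchy s → ∃[ x ] s ⟶ x

  commutativeRing : CommutativeRing c ℓ₁
  commutativeRing = HeytingCommutativeRing.commutativeRing heytingCommutativeRing

  private
    module < = IsStrictPartialOrder isStrictPartialOrder

    open import Algebra.Properties.Ring (CommutativeRing.ring commutativeRing) using (-1*x≈-x; -‿involutive)

    0<1 : 0# < 1#
    0<1 with #⇒< (1#0 heytingCommutativeRing)
    ... | inj₂ 0<1 = 0<1
    ... | inj₁ 1<0 = <.<-respʳ-≈ (trans (-1*x≈-x (- 1#)) (-‿involutive 1#)) (*-pos 0<-1 0<-1)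
      where
      0<-1 : 0# < - 1#
      0<-1 = <.<-respˡ-≈ (-‿inverseʳ 1#)
               (<.<-respʳ-≈ (+-identityˡ (- 1#)) (+-monoˡ-< (- 1#) 1<0))

    0<fromℕ : ∀ n → 0# < fromℕ (suc n)
    0<fromℕ zero    = <.<-respʳ-≈ (sym (+-identityʳ 1#)) 0<1
    0<fromℕ (suc n) = <.trans (0<fromℕ n)
      (<.<-respˡ-≈ (+-identityˡ _) (+-monoˡ-< (fromℕ (suc n)) 0<1))

  1/ : ∀ n → .{{NonZero n}} → Carrier
  1/ (suc n) = proj₁ (#⇒invertible (#-sym (<⇒# (0<fromℕ n))))

  1/-inverse : ∀ n .{{_ : NonZero n}} → fromℕ n * 1/ n ≈ 1#
  1/-inverse (suc n) = trans
    (*-congʳ (sym (x-0≈x heytingCommutativeRing _)))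
    (proj₂ (proj₂ (#⇒invertible (#-sym (<⇒# (0<fromℕ n))))))

  fromℤ : ℤ → Carrier
  fromℤ (+ n)    = fromℕ n
  fromℤ -[1+ n ] = - fromℕ (suc n)

------------------------------------------------------------------------
-- Complex numbers, the modulus, the exponential function and π

module Complex {c ℓ₁ ℓ₂ ℓ₃} (ℝ : RealNumbers c ℓ₁ ℓ₂ ℓ₃) where
  open RealNumbers ℝ

  infix 5 _+i_
  record ℂ : Set c where
    constructor _+i_
    field
      re im : Carrier
  open ℂ public

  infixl 6 _+ᶜ_
  infixl 7 _*ᶜ_
  infixr 7 _∙ᶜ_
  infixr 8 _^ᶜ_

  0ᶜ 1ᶜ : ℂ
  0ᶜ = 0# +i 0#
  1ᶜ = 1# +i 0#

  _+ᶜ_ : ℂ → ℂ → ℂ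
  (a +i b) +ᶜ (c +i d) = (a + c) +i (b + d)

  _*ᶜ_ : ℂ → ℂ → ℂ
  (a +i b) *ᶜ (c +i d) = (a * c - b * d) +i (a * d + b * c)

  _∙ᶜ_ : Carrier → ℂ → ℂ
  r ∙ᶜ (a +i b) = (r * a) +i (r * b)

  _^ᶜ_ : ℂ → ℕ → ℂ
  z ^ᶜ zero  = 1ᶜ
  z ^ᶜ suc n = z *ᶜ z ^ᶜ n

  -- IsModulus, IsExp and IsPi each determine the object they describe
  -- uniquely (up to _≈_), so quantifying over everything satisfying them
  -- amounts to speaking of the modulus, the exponential function and π.

  IsModulus : (ℂ → Carrier) → Set (c ⊔ ℓ₁ ⊔ ℓ₃)
  IsModulus ∣_∣ = ∀ z →
    ¬ (∣ z ∣ < 0#) × (∣ z ∣ * ∣ z ∣ ≈ re z * re z + im z * im z)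

  expPartialSum : ℂ → ℕ → ℂ
  expPartialSum z zero    = 0ᶜ
  expPartialSum z (suc n) =
    expPartialSum z n +ᶜ 1/ (n !) {{n ℕ.!≢0}} ∙ᶜ z ^ᶜ n

  IsExp : (ℂ → ℂ) → Set (c ⊔ ℓ₃)
  IsExp exp = ∀ z →
    ((re ∘ expPartialSum z) ⟶ re (exp z)) × ((im ∘ expPartialSum z) ⟶ im (exp z))

  -- π/2 is the least positive zero of cos, where cos t = Re (exp (i t)).
  IsPi : (ℂ → ℂ) → Carrier → Set (c ⊔ ℓ₁ ⊔ ℓ₃)
  IsPi exp π =
    0# < π/2 × cos π/2 ≈ 0# × (∀ t → 0# < t → cos t ≈ 0# → ¬ (t < π/2))
    where
    π/2 = π * 1/ 2
    cos : Carrier → Carrier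
    cos t = re (exp (0# +i t))

  -- 2π m i / d
  2πi[_]_/_ : Carrier → ℤ → ∀ d → .{{NonZero d}} → ℂ
  2πi[ π ] m / d = 0# +i (fromℕ 2 * π * fromℤ m * 1/ d)

------------------------------------------------------------------------
-- Finite groups and finite simple graphs

record FiniteGroup c ℓ : Set (lsuc (c ⊔ ℓ)) where
  field
    group       : Group c ℓ
  open Group group public
  field
    _≟_         : Decidable _≈_
    order       : ℕ
    enumeration : Bijection (≡.setoid (Fin order)) setoid

record FiniteSimpleGraph c ℓ a : Set (lsuc (c ⊔ ℓ ⊔ a)) where
  field
    vertices    : Setoid c ℓ
  open Setoid vertices public renaming (Carrier to Vertex)
  field
    order       : ℕ
    enumeration : Bijection (≡.setoid (Fin order)) vertices
    _~_         : Rel Vertex a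
    _~?_        : Decidable _~_
    ~-resp-≈    : _~_ Respects₂ _≈_
    ~-sym       : Symmetric _~_
    ~-irrefl    : Irreflexive _≈_ _~_

  vertex : Fin order → Vertex
  vertex = Bijection.to enumeration

module _ {c ℓ} (G : FiniteGroup c ℓ) where
  open FiniteGroup G
  open import Algebra.Properties.Group group using (identityʳ-unique)
  open import Relation.Binary.Reasoning.Setoid setoid

  Cay : (S : List Carrier) →
        All (λ s → Any (s ⁻¹ ≈_) S) S →
        All (λ s → ¬ s ≈ ε) S →
        FiniteSimpleGraph c ℓ (c ⊔ ℓ)
  Cay S S⁻¹⊆S 1∉S = record
    { vertices    = setoid
    ; order       = order
    ; enumeration = enumeration
    ; _~_         = λ ξ η → Any (λ s → η ≈ ξ ∙ s) S
    ; _~?_        = λ ξ η → Any.any? (λ s → η ≟ (ξ ∙ s)) S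
    ; ~-resp-≈    = (λ η≈η′ → Any.map (trans (sym η≈η′)))
                  , (λ ξ≈ξ′ → Any.map (λ p → trans p (∙-congʳ ξ≈ξ′)))
    ; ~-sym       = λ {ξ} {η} → All.lookupWith (λ {s} s⁻¹∈S p → Any.map (flip-edge p) s⁻¹∈S) S⁻¹⊆S
    ; ~-irrefl    = λ {ξ} {η} ξ≈η → All.lookupWith
                      (λ {s} s≉ε p → s≉ε (identityʳ-unique ξ s (sym (trans ξ≈η p)))) 1∉S
    }
    where
    flip-edge : ∀ {ξ η s t} → η ≈ ξ ∙ s → s ⁻¹ ≈ t → ξ ≈ η ∙ t
    flip-edge {ξ} {η} {s} {t} p q = begin
      ξ              ≈⟨ identityʳ ξ ⟨
      ξ ∙ ε          ≈⟨ ∙-congˡ (inverseʳ s) ⟨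
      ξ ∙ (s ∙ s ⁻¹) ≈⟨ assoc ξ s (s ⁻¹) ⟨
      (ξ ∙ s) ∙ s ⁻¹ ≈⟨ ∙-cong (sym p) q ⟩
      η ∙ t          ∎

------------------------------------------------------------------------
-- Symmetric groups

-- Permutations are multiplied as functions: (ξ ∙ η) i = ξ (η i);
-- Perm._∘ₚ_ composes in diagrammatic order.

symmetricGroup : ℕ → Group 0ℓ 0ℓ
symmetricGroup n = record
  { Carrier = Permutation′ n
  ; _≈_     = Perm._≈_
  ; _∙_     = λ ξ η → η ∘ₚ ξ
  ; ε       = Perm.id
  ; _⁻¹     = Perm.flip
  ; isGroup = record
    { isMonoid = record
      { isSemigroup = record
        { isMagma = record
          { isEquivalence = record
            { refl  = λ _ → refl
            ; sym   = λ p i → ≡.sym (p i)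
            ; trans = λ p q i → ≡.trans (p i) (q i)
            }
          ; ∙-cong = λ {ξ} {ξ′} {η} {η′} p q i → ≡.trans (cong (ξ ⟨$⟩ʳ_) (q i)) (p (η′ ⟨$⟩ʳ i))
          }
        ; assoc = λ _ _ _ _ → refl
        }
      ; identity = (λ _ _ → refl) , (λ _ _ → refl)
      }
    ; inverse = (λ ξ _ → Perm.inverseˡ ξ) , (λ ξ _ → Perm.inverseʳ ξ)
    ; ⁻¹-cong = λ {ξ} {η} p i → ≡.trans
        (cong (ξ ⟨$⟩ˡ_) (≡.trans (≡.sym (Perm.inverseʳ η)) (≡.sym (p (η ⟨$⟩ˡ i)))))
        (Perm.inverseˡ ξ)
    }
  }

-- The two components of an index choose the image of 0 and the
-- bijection between the remaining elements.

enumerate : ∀ n → Fin (n !) → Permutation′ n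
enumerate zero    _ = Perm.id
enumerate (suc n) i =
  let (j , k) = remQuot (n !) i in insert 0F j (enumerate n k)

enumerate-injective : ∀ n {i j} → enumerate n i Perm.≈ enumerate n j → i ≡ j
enumerate-injective zero {0F} {0F} _ = refl
enumerate-injective (suc n) {i} {j} p = begin
  i                  ≡⟨ Fin.combine-remQuot {suc n} (n !) i ⟨
  combine i₀ i₁      ≡⟨ cong₂ combine (p 0F) (enumerate-injective n rest) ⟩
  combine j₀ j₁      ≡⟨ Fin.combine-remQuot {suc n} (n !) j ⟩
  j                  ∎
  where
  open ≡.≡-Reasoning
  i₀ = proj₁ (remQuot {suc n} (n !) i)
  i₁ = proj₂ (remQuot {suc n} (n !) i)
  j₀ = proj₁ (remQuot {suc n} (n !) j)
  j₁ = proj₂ (remQuot {suc n} (n !) j)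

  rest : enumerate n i₁ Perm.≈ enumerate n j₁
  rest k = Fin.punchIn-injective i₀ _ _ (begin
    punchIn i₀ (enumerate n i₁ ⟨$⟩ʳ k) ≡⟨ insert-punchIn 0F i₀ (enumerate n i₁) k ⟨
    enumerate (suc n) i ⟨$⟩ʳ suc k     ≡⟨ p (suc k) ⟩
    enumerate (suc n) j ⟨$⟩ʳ suc k     ≡⟨ insert-punchIn 0F j₀ (enumerate n j₁) k ⟩
    punchIn j₀ (enumerate n j₁ ⟨$⟩ʳ k) ≡⟨ cong (λ x → punchIn x (enumerate n j₁ ⟨$⟩ʳ k)) (p 0F) ⟨
    punchIn i₀ (enumerate n j₁ ⟨$⟩ʳ k) ∎)

enumerate-surjective : ∀ n (ξ : Permutation′ n) → ∃[ i ] enumerate n i Perm.≈ ξ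
enumerate-surjective zero    ξ = 0F , λ ()
enumerate-surjective (suc n) ξ =
  combine (ξ ⟨$⟩ʳ 0F) (proj₁ ih) , λ where
    0F      → cong proj₁ split
    (suc k) → begin
      enumerate (suc n) (combine (ξ ⟨$⟩ʳ 0F) (proj₁ ih)) ⟨$⟩ʳ suc k
        ≡⟨ cong (λ (j , l) → insert 0F j (enumerate n l) ⟨$⟩ʳ suc k) split ⟩
      punchIn (ξ ⟨$⟩ʳ 0F) (enumerate n (proj₁ ih) ⟨$⟩ʳ k)
        ≡⟨ cong (punchIn (ξ ⟨$⟩ʳ 0F)) (proj₂ ih k) ⟩
      punchIn (ξ ⟨$⟩ʳ 0F) (remove 0F ξ ⟨$⟩ʳ k)
        ≡⟨ insert-remove 0F ξ (suc k) ⟩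
      ξ ⟨$⟩ʳ suc k ∎
  where
  open ≡.≡-Reasoning
  ih    = enumerate-surjective n (remove 0F ξ)
  split = Fin.remQuot-combine (ξ ⟨$⟩ʳ 0F) (proj₁ ih)

𝔖 : ℕ → FiniteGroup 0ℓ 0ℓ
𝔖 n = record
  { group       = symmetricGroup n
  ; _≟_         = λ ξ η → Fin.all? (λ i → (ξ ⟨$⟩ʳ i) Fin.≟ (η ⟨$⟩ʳ i))
  ; order       = n !
  ; enumeration = record
    { to        = enumerate n
    ; cong      = λ where refl _ → refl
    ; bijective = enumerate-injective n
                , λ ξ → let (i , p) = enumerate-surjective n ξ in i , λ where refl → p
    }
  }

-- (1,4), (2,4), (3,4), with the points 1, 2, 3, 4 written 0F, 1F, 2F, 3F.

transpositions : List (Permutation′ 4)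
transpositions = transpose 0F 3F ∷ transpose 1F 3F ∷ transpose 2F 3F ∷ []

X₃ : FiniteSimpleGraph 0ℓ 0ℓ 0ℓ
X₃ = Cay (𝔖 4) transpositions
  (from-yes (All.all? (λ s → Any.any? ((s ⁻¹) ≟_) transpositions) transpositions))
  (from-yes (All.all? (λ s → ¬? (s ≟ ε)) transpositions))
  where open FiniteGroup (𝔖 4)

------------------------------------------------------------------------
-- The spectrum of a finite simple graph

module Spectrum {c ℓ₁ ℓ₂ ℓ₃} (ℝ : RealNumbers c ℓ₁ ℓ₂ ℓ₃) where
  open RealNumbers ℝ
  open import Algebra.Definitions.RawMonoid
    (CommutativeRing.+-rawMonoid commutativeRing) using (sum)

  Matrix : ℕ → Set c
  Matrix n = Fin n → Fin n → Carrier

  det : ∀ {n} → Matrix n → Carrier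
  det {zero}  M = 1#
  det {suc n} M = sum λ j →
    sign (toℕ j) * M 0F j * det (λ i k → M (suc i) (punchIn j k))
    where
    sign : ℕ → Carrier
    sign zero    = 1#
    sign (suc k) = - sign k

  scalar : ∀ {n} → Carrier → Matrix n
  scalar x i j = if does (i Fin.≟ j) then x else 0#

  charPoly : ∀ {n} → Matrix n → Carrier → Carrier
  charPoly A x = det (λ i j → scalar x i j - A i j)

  adjacencyMatrix : ∀ {v ℓ a} (Γ : FiniteSimpleGraph v ℓ a) →
                    Matrix (FiniteSimpleGraph.order Γ)
  adjacencyMatrix Γ i j = if does (vertex i ~? vertex j) then 1# else 0#
    where open FiniteSimpleGraph Γ

  -- Γ has spectrum λ₁, …, λₘ (in any order) if det (x I - A) = ∏ (x - λₖ),
  -- that is, if the λₖ are the roots of the characteristic polynomial of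
  -- its adjacency matrix A, listed with multiplicity.  Polynomials over
  -- the infinite field ℝ are identified with the functions they define.

  HasSpectrum : ∀ {v ℓ a} → FiniteSimpleGraph v ℓ a → List Carrier → Set (c ⊔ ℓ₁)
  HasSpectrum Γ λs = ∀ x →
    charPoly (adjacencyMatrix Γ) x ≈ List.foldr (λ λₖ p → (x - λₖ) * p) 1# λs

{-# OPTIONS --safe #-}

-- Since (x - r)(x + r) = x² - r², only the squares r² matter.  They are norms of
-- Eisenstein integers, because ω = exp (πi/3) satisfies ω² = ω - 1: the addition
-- theorem gives 0 = cos 3θ = cos θ (4 cos² θ - 3) for θ = π/6, and cos θ ≠ 0 as π/2
-- is the first zero of cos.  Hence the claimed spectrum is ±3, ±2 (six times),
-- ±1 (three times) and 0 (four times).  On the other side an integer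
-- matrix P of orthogonal left eigenvectors gives P (x I - A) = E P with E diagonal, and the
-- multiplicativity of the determinant yields det (x I - A) = det E.
module Submission where

open import Defs
open import Algebra.Apartness.Bundles using (HeytingField)
open import Algebra.Apartness.Properties.HeytingCommutativeRing using (1#0; x-0≈x)
open import Algebra.Bundles using (CommutativeRing)
import Algebra.Solver.Ring as RingSolver
open import Algebra.Solver.Ring.AlmostCommutativeRing using (fromCommutativeRing; _-Raw-AlmostCommutative⟶_)
open import Data.Bool.Base using (Bool; true; false; if_then_else_)
open import Data.Empty using (⊥-elim)
open import Data.Fin.Base using (Fin; zero; suc; toℕ; punchIn; punchOut)
import Data.Fin.Properties as Fin
open import Data.Integer.Base as ℤ using (ℤ; +_; -[1+_])
import Data.Integer.Literals as Literals
import Data.Integer.Properties as ℤ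
open import Data.List.Base as List using (List; _∷_; []; allFin; cartesianProduct; concatMap)
open import Data.Maybe.Base as Maybe using (Maybe)
open import Data.Nat.Base as ℕ using (ℕ; zero; suc; _!; NonZero)
import Data.Nat.Properties as ℕ
open import Data.Product.Base using (∃-syntax; _×_; _,_; proj₁; proj₂)
open import Data.Sum.Base as Sum using (_⊎_; inj₁; inj₂)
open import Data.Unit.Base using (tt)
open import Data.Vec.Base as Vec using (Vec; []; _∷_)
open import Data.Vec.Functional as Vector using (Vector; insertAt) renaming (_∷_ to _◂_)
open import Data.Vec.Functional.Properties using (insertAt-lookup; insertAt-punchIn)
open import Function.Base using (_∘_)
open import Level using (_⊔_)
open import Relation.Binary.PropositionalEquality as ≡ using (_≡_; _≢_; refl; cong)
open import Relation.Binary.Structures using (IsStrictPartialOrder)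
open import Relation.Nullary.Decidable using (does; yes; no; from-yes; _⊎-dec_; ¬?; dec⇒maybe)
open import Relation.Nullary.Negation using (¬_)

-- Neither equality nor order on the reals is decidable here. Every finite computation is therefore
-- done over ℤ, where evaluation settles it, and carried over along the homomorphism from ℤ;
-- equalities that come from analysis are proved by refuting apartness. The determinant is given as
-- an expansion along the first row, a form in which it is awkward to see that two equal rows give
-- 0. The expansion along the first column is shown to be alternating instead, and the uniqueness of
-- alternating multilinear forms then yields both the agreement of the two expansions and
-- multiplicativity. Orthogonality of the rows of P makes P times its transpose an invertible
-- diagonal matrix, which is what allows det P to be cancelled. Of the exponential only the
-- convergence of its partial sums is given. The addition theorem rests on the recurrence (n + 1)
-- aₙ₊₁ = z aₙ, which characterises the terms zⁿ/n!, and on dominating the error by a real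
-- exponential series.

-- The homomorphism from ℤ to a commutative ring, and a ring solver with integer coefficients

module Integers {c ℓ} (R : CommutativeRing c ℓ) where
  open CommutativeRing R renaming (refl to ≈-refl; zero to *-zero)
  open import Algebra.Properties.Ring ring using (-0#≈0#; -‿involutive; -‿distribˡ-*; -‿distribʳ-*; -‿+-comm)
  open import Algebra.Properties.Semiring.Mult semiring using (×-homo-+; ×1-homo-*) renaming (_×_ to _·_)
  open import Relation.Binary.Reasoning.Setoid setoid

  -- On naturals this unfolds to the same multiple of `1#` as `fromℕ`, so the solver's numerals
  -- `con (+ n)` match the real numbers `fromℕ n` by computation.
  ⟦_⟧ : ℤ → Carrier
  ⟦ + n ⟧      = n · 1#
  ⟦ -[1+ n ] ⟧ = - (suc n · 1#)

  ⟦⟧-⊖ : ∀ m n → ⟦ m ℤ.⊖ n ⟧ ≈ m · 1# - n · 1#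
  ⟦⟧-⊖ m zero = sym (trans (+-congˡ -0#≈0#) (+-identityʳ _))
  ⟦⟧-⊖ zero (suc n) = sym (+-identityˡ _)
  ⟦⟧-⊖ (suc m) (suc n) = begin
    ⟦ suc m ℤ.⊖ suc n ⟧                 ≡⟨ cong ⟦_⟧ (ℤ.[1+m]⊖[1+n]≡m⊖n m n) ⟩
    ⟦ m ℤ.⊖ n ⟧                         ≈⟨ ⟦⟧-⊖ m n ⟩
    m · 1# - n · 1#                     ≈⟨ +-congʳ (+-identityˡ _) ⟨
    0# + m · 1# - n · 1#                ≈⟨ +-congʳ (+-congʳ (-‿inverseʳ 1#)) ⟨
    1# - 1# + m · 1# - n · 1#           ≈⟨ +-congʳ (trans (+-assoc _ _ _) (trans (+-congˡ (+-comm _ _)) (sym (+-assoc _ _ _)))) ⟩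
    1# + m · 1# - 1# - n · 1#           ≈⟨ +-assoc _ _ _ ⟩
    1# + m · 1# + (- 1# - n · 1#)       ≈⟨ +-congˡ (-‿+-comm _ _) ⟩
    (suc m · 1#) - (suc n · 1#)         ∎

  ⟦⟧-+ : ∀ i j → ⟦ i ℤ.+ j ⟧ ≈ ⟦ i ⟧ + ⟦ j ⟧
  ⟦⟧-+ (+ m)    (+ n)    = ×-homo-+ 1# m n
  ⟦⟧-+ (+ m)    -[1+ n ] = ⟦⟧-⊖ m (suc n)
  ⟦⟧-+ -[1+ m ] (+ n)    = trans (⟦⟧-⊖ n (suc m)) (+-comm _ _)
  ⟦⟧-+ -[1+ m ] -[1+ n ] = begin
    - (suc (suc (m ℕ.+ n)) · 1#)        ≡⟨ cong (λ k → - (suc k · 1#)) (ℕ.+-suc m n) ⟨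
    - ((suc m ℕ.+ suc n) · 1#)          ≈⟨ -‿cong (×-homo-+ 1# (suc m) (suc n)) ⟩
    - (suc m · 1# + suc n · 1#)         ≈⟨ -‿+-comm _ _ ⟨
    - (suc m · 1#) - (suc n · 1#)       ∎

  ⟦⟧-neg : ∀ i → ⟦ ℤ.- i ⟧ ≈ - ⟦ i ⟧
  ⟦⟧-neg (+ zero)  = sym -0#≈0#
  ⟦⟧-neg (+ suc n) = ≈-refl
  ⟦⟧-neg -[1+ n ]  = sym (-‿involutive _)

  ⟦+⟧-* : ∀ m j → ⟦ + m ℤ.* j ⟧ ≈ ⟦ + m ⟧ * ⟦ j ⟧
  ⟦+⟧-* m (+ n) = trans (reflexive (cong ⟦_⟧ (≡.sym (ℤ.pos-* m n)))) (×1-homo-* m n)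
  ⟦+⟧-* m -[1+ n ] = begin
    ⟦ + m ℤ.* ℤ.- (+ suc n) ⟧           ≡⟨ cong ⟦_⟧ (ℤ.neg-distribʳ-* (+ m) (+ suc n)) ⟨
    ⟦ ℤ.- (+ m ℤ.* + suc n) ⟧           ≈⟨ ⟦⟧-neg (+ m ℤ.* + suc n) ⟩
    - ⟦ + m ℤ.* + suc n ⟧               ≈⟨ -‿cong (⟦+⟧-* m (+ suc n)) ⟩
    - (⟦ + m ⟧ * ⟦ + suc n ⟧)           ≈⟨ -‿distribʳ-* _ _ ⟩
    ⟦ + m ⟧ * ⟦ -[1+ n ] ⟧              ∎

  ⟦⟧-* : ∀ i j → ⟦ i ℤ.* j ⟧ ≈ ⟦ i ⟧ * ⟦ j ⟧
  ⟦⟧-* (+ m)    j = ⟦+⟧-* m j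
  ⟦⟧-* -[1+ m ] j = begin
    ⟦ ℤ.- (+ suc m) ℤ.* j ⟧             ≡⟨ cong ⟦_⟧ (ℤ.neg-distribˡ-* (+ suc m) j) ⟨
    ⟦ ℤ.- (+ suc m ℤ.* j) ⟧             ≈⟨ ⟦⟧-neg (+ suc m ℤ.* j) ⟩
    - ⟦ + suc m ℤ.* j ⟧                 ≈⟨ -‿cong (⟦+⟧-* (suc m) j) ⟩
    - (⟦ + suc m ⟧ * ⟦ j ⟧)             ≈⟨ -‿distribˡ-* _ _ ⟩
    ⟦ -[1+ m ] ⟧ * ⟦ j ⟧                ∎

  -- The left side unfolds to `1# + 0#` and is not `1#` by computation. For the same reason later
  -- solver calls pass `1#` as a variable.
  ⟦⟧-1 : ⟦ + 1 ⟧ ≈ 1#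
  ⟦⟧-1 = +-identityʳ 1#

  morphism : ℤ.+-*-rawRing -Raw-AlmostCommutative⟶ fromCommutativeRing R
  morphism = record
    { ⟦_⟧    = ⟦_⟧
    ; +-homo = ⟦⟧-+
    ; *-homo = ⟦⟧-*
    ; -‿homo = ⟦⟧-neg
    ; 0-homo = ≈-refl
    ; 1-homo = ⟦⟧-1
    }

  -- The solver only has to recognise equal coefficients, so deciding equality in ℤ is enough even
  -- though equality in the ring is not decidable.
  ⟦⟧-≟ : ∀ i j → Maybe (⟦ i ⟧ ≈ ⟦ j ⟧)
  ⟦⟧-≟ i j = Maybe.map (λ i≡j → reflexive (cong ⟦_⟧ i≡j)) (dec⇒maybe (i ℤ.≟ j))

  module Solver = RingSolver ℤ.+-*-rawRing (fromCommutativeRing R) morphism ⟦⟧-≟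

-- Determinants

-- Alternation is demanded for neighbouring rows only. Two equal neighbours have equal minors and
-- opposite signs in a column expansion; for distant rows the minors would differ by a cyclic shift.
data Adjacent : ∀ {n} → Fin n → Fin n → Set where
  here  : ∀ {n} → Adjacent {suc (suc n)} zero (suc zero)
  there : ∀ {n} {i k : Fin n} → Adjacent i k → Adjacent (suc i) (suc k)

adjacent-toℕ : ∀ {n} {i k : Fin n} → Adjacent i k → toℕ k ≡ suc (toℕ i)
adjacent-toℕ here      = refl
adjacent-toℕ (there p) = cong suc (adjacent-toℕ p)

-- Neighbours stay neighbours when a third row is deleted, which lets the induction pass to a minor.
adjacent-punchOut : ∀ {n} {i k l : Fin (suc n)} → Adjacent i k → l ≢ i → l ≢ k →
  ∃[ i′ ] ∃[ k′ ] Adjacent i′ k′ × punchIn l i′ ≡ i × punchIn l k′ ≡ k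
adjacent-punchOut {l = zero}        here      l≢i l≢k = ⊥-elim (l≢i refl)
adjacent-punchOut {l = suc zero}    here      l≢i l≢k = ⊥-elim (l≢k refl)
adjacent-punchOut {suc (suc n)} {l = suc (suc l)} here l≢i l≢k = zero , suc zero , here , refl , refl
adjacent-punchOut {l = zero}        (there p) l≢i l≢k = _ , _ , p , refl , refl
adjacent-punchOut {suc n} {l = suc l} (there p) l≢i l≢k =
  let (i′ , k′ , p′ , q , r) = adjacent-punchOut p (l≢i ∘ cong suc) (l≢k ∘ cong suc)
  in suc i′ , suc k′ , there p′ , cong suc q , cong suc r

-- Deleting one or the other of two neighbours leaves the same rows in the same places, except for
-- one place where the survivor stands.
adjacent-punchIn : ∀ {n} {i k : Fin (suc n)} → Adjacent i k → ∀ r →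
  punchIn i r ≡ punchIn k r ⊎ (punchIn i r ≡ k × punchIn k r ≡ i)
adjacent-punchIn here      zero    = inj₂ (refl , refl)
adjacent-punchIn here      (suc r) = inj₁ refl
adjacent-punchIn (there p) zero    = inj₁ refl
adjacent-punchIn (there p) (suc r) =
  Sum.map (cong suc) (λ (q , q′) → cong suc q , cong suc q′) (adjacent-punchIn p r)

module Determinants {c ℓ} (R : CommutativeRing c ℓ) where
  open CommutativeRing R renaming (refl to ≈-refl; zero to *-zero)
  open Integers R using (module Solver)
  open Solver using (solve; _:=_; _:+_; _:*_; :-_; con)
  open import Algebra.Properties.Ring ring using (x+x≈x⇒x≈0)
  open import Algebra.Properties.Semiring.Sum semiring
    using (sum; sum-cong-≋; ∑-distrib-+; *-distribˡ-sum; sum-replicate-zero)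
  open import Relation.Binary.Reasoning.Setoid setoid

  Matrix : ℕ → ℕ → Set c
  Matrix n m = Fin n → Fin m → Carrier

  infix 4 _≋_
  _≋_ : ∀ {n m} → Matrix n m → Matrix n m → Set ℓ
  M ≋ N = ∀ i j → M i j ≈ N i j

  ◂-cong : ∀ {n m} {u v : Vector Carrier m} {M N : Matrix n m} →
           (∀ j → u j ≈ v j) → M ≋ N → (u ◂ M) ≋ (v ◂ N)
  ◂-cong p q zero    = p
  ◂-cong p q (suc i) = q i

  ◂-η : ∀ {n m} (M : Matrix (suc n) m) → (M zero ◂ (M ∘ suc)) ≋ M
  ◂-η M zero    j = ≈-refl
  ◂-η M (suc i) j = ≈-refl

  -- Recursive rather than by a test on indices, so that products with it are computed by induction
  -- on the size.
  diagonal : ∀ {n} → Vector Carrier n → Matrix n n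
  diagonal d zero    zero    = d zero
  diagonal d zero    (suc j) = 0#
  diagonal d (suc i) zero    = 0#
  diagonal d (suc i) (suc j) = diagonal (d ∘ suc) i j

  𝟙 : ∀ {n} → Matrix n n
  𝟙 = diagonal (λ _ → 1#)

  diagonal-≡ : ∀ {n} (d : Vector Carrier n) i → diagonal d i i ≡ d i
  diagonal-≡ d zero    = refl
  diagonal-≡ d (suc i) = diagonal-≡ (d ∘ suc) i

  diagonal-≢ : ∀ {n} (d : Vector Carrier n) {i j} → i ≢ j → diagonal d i j ≡ 0#
  diagonal-≢ d {zero}  {zero}  i≢j = ⊥-elim (i≢j refl)
  diagonal-≢ d {zero}  {suc j} i≢j = refl
  diagonal-≢ d {suc i} {zero}  i≢j = refl
  diagonal-≢ d {suc i} {suc j} i≢j = diagonal-≢ (d ∘ suc) (i≢j ∘ cong suc)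

  𝟙-punchIn : ∀ {n} j (i k : Fin n) → 𝟙 (punchIn j i) (punchIn j k) ≡ 𝟙 i k
  𝟙-punchIn zero    i       k       = refl
  𝟙-punchIn (suc j) zero    zero    = refl
  𝟙-punchIn (suc j) zero    (suc k) = refl
  𝟙-punchIn (suc j) (suc i) zero    = refl
  𝟙-punchIn (suc j) (suc i) (suc k) = 𝟙-punchIn j i k

  infixl 7 _⊗_
  _⊗_ : ∀ {n m l} → Matrix n m → Matrix m l → Matrix n l
  (M ⊗ N) i k = sum λ j → M i j * N j k

  sum-linear : ∀ {n} a {x y z : Vector Carrier n} → (∀ i → x i ≈ a * y i + z i) →
               sum x ≈ a * sum y + sum z
  sum-linear a {x} {y} {z} p = begin
    sum x                           ≈⟨ sum-cong-≋ p ⟩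
    sum (λ i → a * y i + z i)       ≈⟨ ∑-distrib-+ (λ i → a * y i) z ⟩
    sum (λ i → a * y i) + sum z     ≈⟨ +-congʳ (*-distribˡ-sum a y) ⟨
    a * sum y + sum z               ∎

  sum-zero : ∀ {n} (x : Vector Carrier n) → (∀ i → x i ≈ 0#) → sum x ≈ 0#
  sum-zero {n} x p = trans (sum-cong-≋ p) (sum-replicate-zero n)

  sum-diagonalˡ : ∀ {n} (d x : Vector Carrier n) i →
                  sum (λ j → diagonal d i j * x j) ≈ d i * x i
  sum-diagonalˡ d x zero    = trans (+-congˡ (sum-zero (λ j → 0# * x (suc j)) λ _ → zeroˡ _)) (+-identityʳ _)
  sum-diagonalˡ d x (suc i) = trans (+-cong (zeroˡ _) (sum-diagonalˡ (d ∘ suc) (x ∘ suc) i)) (+-identityˡ _)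

  sum-diagonalʳ : ∀ {n} (d x : Vector Carrier n) i →
                  sum (λ j → x j * diagonal d j i) ≈ x i * d i
  sum-diagonalʳ d x zero    = trans (+-congˡ (sum-zero (λ j → x (suc j) * 0#) λ _ → zeroʳ _)) (+-identityʳ _)
  sum-diagonalʳ d x (suc i) = trans (+-cong (zeroʳ _) (sum-diagonalʳ (d ∘ suc) (x ∘ suc) i)) (+-identityˡ _)

  sum-adjacent : ∀ {n} {t : Vector Carrier n} {i k} → Adjacent i k →
                 t i + t k ≈ 0# → (∀ l → l ≢ i → l ≢ k → t l ≈ 0#) → sum t ≈ 0#
  sum-adjacent {t = t} here p q = begin
    t zero + (t (suc zero) + sum (λ l → t (suc (suc l)))) ≈⟨ +-assoc _ _ _ ⟨
    t zero + t (suc zero) + sum (λ l → t (suc (suc l)))   ≈⟨ +-cong p (sum-zero (λ l → t (suc (suc l))) λ l → q (suc (suc l)) (λ ()) (λ ())) ⟩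
    0# + 0#                                               ≈⟨ +-identityʳ 0# ⟩
    0#                                                    ∎
  sum-adjacent {t = t} (there a) p q = trans
    (+-cong (q zero (λ ()) (λ ()))
            (sum-adjacent a p (λ l l≢i l≢k → q (suc l) (l≢i ∘ Fin.suc-injective) (l≢k ∘ Fin.suc-injective))))
    (+-identityʳ 0#)

  sign : ℕ → Carrier
  sign zero    = 1#
  sign (suc k) = - sign k

  minor : ∀ {n} → Matrix (suc n) (suc n) → Fin (suc n) → Matrix n n
  minor M j i k = M (suc i) (punchIn j k)

  det : ∀ {n} → Matrix n n → Carrier
  det {zero}  M = 1#
  det {suc n} M = sum λ j → sign (toℕ j) * M zero j * det (minor M j)

  minorᶜ : ∀ {n} → Matrix (suc n) (suc n) → Fin (suc n) → Matrix n n
  minorᶜ M i r k = M (punchIn i r) (suc k)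

  -- Expansion along the first column treats all rows alike, so linearity and alternation in the
  -- rows can be checked summand by summand.
  detᶜ : ∀ {n} → Matrix n n → Carrier
  detᶜ {zero}  M = 1#
  detᶜ {suc n} M = sum λ i → sign (toℕ i) * M i zero * detᶜ (minorᶜ M i)

  record IsAlternating {n m} (f : Matrix n m → Carrier) : Set (c ⊔ ℓ) where
    field
      f-cong      : ∀ {M N} → M ≋ N → f M ≈ f N
      linear      : ∀ i a {L M N} →
                    (∀ k → k ≢ i → ∀ j → L k j ≈ M k j) →
                    (∀ k → k ≢ i → ∀ j → L k j ≈ N k j) →
                    (∀ j → L i j ≈ a * M i j + N i j) →
                    f L ≈ a * f M + f N
      alternating : ∀ {i k M} → Adjacent i k → (∀ j → M i j ≈ M k j) → f M ≈ 0#

  open IsAlternating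

  fix-first : ∀ {n m} {f : Matrix (suc n) m → Carrier} → IsAlternating f →
              ∀ u → IsAlternating (λ N → f (u ◂ N))
  fix-first alt u = record
    { f-cong      = λ p → f-cong alt (◂-cong (λ _ → ≈-refl) p)
    ; linear      = λ i a p q r → linear alt (suc i) a
        (λ { zero _ _ → ≈-refl ; (suc k) k≢i → p k (k≢i ∘ cong suc) })
        (λ { zero _ _ → ≈-refl ; (suc k) k≢i → q k (k≢i ∘ cong suc) }) r
    ; alternating = λ a p → alternating alt (there a) p
    }

  linear-first : ∀ {n m} {f : Matrix (suc n) m → Carrier} → IsAlternating f →
                 ∀ a {w u v} (N : Matrix n m) → (∀ j → w j ≈ a * u j + v j) →
                 f (w ◂ N) ≈ a * f (u ◂ N) + f (v ◂ N)
  linear-first alt a N p = linear alt zero a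
    (λ { zero k≢0 → ⊥-elim (k≢0 refl) ; (suc k) _ _ → ≈-refl })
    (λ { zero k≢0 → ⊥-elim (k≢0 refl) ; (suc k) _ _ → ≈-refl }) p

  additive-first : ∀ {n m} {f : Matrix (suc n) m → Carrier} → IsAlternating f →
                   ∀ u v (N : Matrix n m) → f ((λ j → u j + v j) ◂ N) ≈ f (u ◂ N) + f (v ◂ N)
  additive-first alt u v N = trans (linear-first alt 1# N (λ j → +-congʳ (sym (*-identityˡ _)))) (+-congʳ (*-identityˡ _))

  -- Polarisation: expand `B w w ≈ 0#` for `w` the sum of `u` and `v`, and drop the two vanishing
  -- diagonal values.
  swap : ∀ {n m} {f : Matrix (suc (suc n)) m → Carrier} → IsAlternating f →
         ∀ u v N → f (u ◂ v ◂ N) ≈ - f (v ◂ u ◂ N)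
  swap {f = f} alt u v N = begin
    B u v                                             ≈⟨ solve 2 (λ x y → x := (x :+ y) :+ :- y) ≈-refl (B u v) (B v u) ⟩
    B u v + B v u - B v u                             ≈⟨ +-congʳ cancel ⟩
    0# - B v u                                        ≈⟨ +-identityˡ _ ⟩
    - B v u                                           ∎
    where
    B : Vector Carrier _ → Vector Carrier _ → Carrier
    B x y = f (x ◂ y ◂ N)
    w : Vector Carrier _
    w j = u j + v j
    diag : ∀ x → B x x ≈ 0#
    diag x = alternating alt here (λ _ → ≈-refl)
    cancel : B u v + B v u ≈ 0#
    cancel = begin
      B u v + B v u                         ≈⟨ solve 2 (λ x y → x :+ y := con (+ 0) :+ x :+ (y :+ con (+ 0))) ≈-refl (B u v) (B v u) ⟩
      0# + B u v + (B v u + 0#)             ≈⟨ +-cong (+-congʳ (diag u)) (+-congˡ (diag v)) ⟨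
      B u u + B u v + (B v u + B v v)       ≈⟨ +-cong (additive-first (fix-first alt u) u v N) (additive-first (fix-first alt v) u v N) ⟨
      B u w + B v w                         ≈⟨ additive-first alt u v (w ◂ N) ⟨
      B w w                                 ≈⟨ diag w ⟩
      0#                                    ∎

  add-first-row : ∀ {n m} {f : Matrix (suc n) m → Carrier} → IsAlternating f →
                  ∀ u (x : Vector Carrier n) N →
                  f (u ◂ (λ i j → x i * u j + N i j)) ≈ f (u ◂ N)
  add-first-row {zero}  alt u x N = f-cong alt (◂-cong (λ _ → ≈-refl) (λ ()))
  add-first-row {suc n} {f = f} alt u x N = begin
    f (u ◂ N⁺)                              ≈⟨ f-cong alt (◂-cong (λ _ → ≈-refl) (◂-η N⁺)) ⟨
    f (u ◂ N⁺ zero ◂ (N⁺ ∘ suc))            ≈⟨ swap alt _ _ _ ⟩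
    -- With `N⁺ zero` exchanged to the top and held fixed, `u` is the first row of a smaller form,
    -- and the induction hypothesis clears all rows below it.
    - f (N⁺ zero ◂ u ◂ (N⁺ ∘ suc))          ≈⟨ -‿cong (add-first-row (fix-first alt _) u (x ∘ suc) (N ∘ suc)) ⟩
    - f (N⁺ zero ◂ u ◂ (N ∘ suc))           ≈⟨ swap alt _ _ _ ⟨
    f (u ◂ N⁺ zero ◂ (N ∘ suc))             ≈⟨ linear-first (fix-first alt u) (x zero) (N ∘ suc) (λ _ → ≈-refl) ⟩
    x zero * f (u ◂ u ◂ (N ∘ suc)) + f (u ◂ N zero ◂ (N ∘ suc))
      ≈⟨ +-cong (*-congˡ (alternating alt here (λ _ → ≈-refl))) (f-cong alt (◂-cong (λ _ → ≈-refl) (◂-η N))) ⟩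
    x zero * 0# + f (u ◂ N)                 ≈⟨ +-congʳ (zeroʳ _) ⟩
    0# + f (u ◂ N)                          ≈⟨ +-identityˡ _ ⟩
    f (u ◂ N)                               ∎
    where
    N⁺ : Matrix (suc n) _
    N⁺ i j = x i * u j + N i j

  -- Row `j` passes `j` rows on its way to the top, and each exchange contributes one sign.
  move-first : ∀ {n m} {f : Matrix (suc n) m → Carrier} → IsAlternating f →
               ∀ j M → f (M j ◂ (M ∘ punchIn j)) ≈ sign (toℕ j) * f M
  move-first alt zero M = trans (f-cong alt (◂-η M)) (sym (*-identityˡ _))
  move-first {suc n} {f = f} alt (suc j) M = begin
    f (M (suc j) ◂ (M ∘ punchIn (suc j)))                 ≈⟨ f-cong alt (◂-cong (λ _ → ≈-refl) (◂-η (M ∘ punchIn (suc j)))) ⟨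
    f (M (suc j) ◂ M zero ◂ (M ∘ suc ∘ punchIn j))        ≈⟨ swap alt _ _ _ ⟩
    - f (M zero ◂ M (suc j) ◂ (M ∘ suc ∘ punchIn j))      ≈⟨ -‿cong (move-first (fix-first alt (M zero)) j (M ∘ suc)) ⟩
    - (sign (toℕ j) * f (M zero ◂ (M ∘ suc)))             ≈⟨ solve 2 (λ x y → :- (x :* y) := (:- x) :* y) ≈-refl _ _ ⟩
    sign (toℕ (suc j)) * f (M zero ◂ (M ∘ suc))           ≈⟨ *-congˡ (f-cong alt (◂-η M)) ⟩
    sign (toℕ (suc j)) * f M                              ∎

  linear-expansion : ∀ {m} (φ : Vector Carrier m → Carrier) →
    (∀ {u v} → (∀ j → u j ≈ v j) → φ u ≈ φ v) →
    (∀ a u v → φ (λ j → a * u j + v j) ≈ a * φ u + φ v) →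
    ∀ u → φ u ≈ sum λ j → u j * φ (𝟙 j)
  -- All vectors of length 0 are pointwise equal, so linearity gives `φ u + φ u ≈ φ u`, whence `φ u`
  -- is zero like the empty sum.
  linear-expansion {zero} φ φ-cong φ-linear u = x+x≈x⇒x≈0 (φ u) (begin
    φ u + φ u                      ≈⟨ +-congʳ (*-identityˡ _) ⟨
    1# * φ u + φ u                 ≈⟨ φ-linear 1# u u ⟨
    φ (λ j → 1# * u j + u j)       ≈⟨ φ-cong (λ ()) ⟩
    φ u                            ∎)
  linear-expansion {suc m} φ φ-cong φ-linear u = begin
    φ u
      ≈⟨ φ-cong (λ { zero → sym (trans (+-identityʳ _) (*-identityʳ _)) ; (suc j) → sym (trans (+-congʳ (zeroʳ _)) (+-identityˡ _)) }) ⟩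
    φ (λ j → u zero * 𝟙 zero j + (0# ◂ (u ∘ suc)) j)
      ≈⟨ φ-linear (u zero) (𝟙 zero) (0# ◂ (u ∘ suc)) ⟩
    u zero * φ (𝟙 zero) + φ (0# ◂ (u ∘ suc))
      ≈⟨ +-congˡ (linear-expansion (λ v → φ (0# ◂ v))
           (λ p → φ-cong λ { zero → ≈-refl ; (suc j) → p j })
           (λ a v w → trans (φ-cong λ { zero → sym (trans (+-identityʳ _) (zeroʳ a)) ; (suc j) → ≈-refl })
                            (φ-linear a (0# ◂ v) (0# ◂ w)))
           (u ∘ suc)) ⟩
    u zero * φ (𝟙 zero) + sum (λ j → u (suc j) * φ (0# ◂ 𝟙 j))
      ≈⟨ +-congˡ (sum-cong-≋ {m} {λ j → u (suc j) * φ (0# ◂ 𝟙 j)} {λ j → u (suc j) * φ (𝟙 (suc j))} λ j → *-congˡ (φ-cong λ { zero → ≈-refl ; (suc k) → ≈-refl })) ⟩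
    sum (λ j → u j * φ (𝟙 j)) ∎

  punchIn-≈ : ∀ {n} j {u v : Vector Carrier (suc n)} →
              u j ≈ v j → (∀ k → u (punchIn j k) ≈ v (punchIn j k)) → ∀ k → u k ≈ v k
  punchIn-≈ zero    p q zero    = p
  punchIn-≈ zero    p q (suc k) = q k
  punchIn-≈ {suc n} (suc j) p q zero    = q zero
  punchIn-≈ {suc n} (suc j) p q (suc k) = punchIn-≈ j p (q ∘ suc) k

  -- Undoes the deletion of column `j` for matrices whose column `j` is zero; composing a form with
  -- it yields a form on shorter rows.
  insertColumn : ∀ {n m} → Fin (suc m) → Matrix n m → Matrix n (suc m)
  insertColumn j N i = insertAt (N i) j 0#

  insertAt-≈ : ∀ {m} j (w : Vector Carrier m) {v : Vector Carrier (suc m)} →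
               0# ≈ v j → (∀ k → w k ≈ v (punchIn j k)) → ∀ k → insertAt w j 0# k ≈ v k
  insertAt-≈ j w p q = punchIn-≈ j (trans (reflexive (insertAt-lookup w j 0#)) p)
    (λ k → trans (reflexive (insertAt-punchIn w j 0# k)) (q k))

  insertAt-linear : ∀ {m} (j : Fin (suc m)) a {w u v : Vector Carrier m} → (∀ k → w k ≈ a * u k + v k) →
    ∀ k → insertAt w j 0# k ≈ a * insertAt u j 0# k + insertAt v j 0# k
  insertAt-linear j a {w} {u} {v} p = insertAt-≈ j w
    (sym (trans (+-cong (trans (*-congˡ (reflexive (insertAt-lookup u j 0#))) (zeroʳ a)) (reflexive (insertAt-lookup v j 0#))) (+-identityʳ 0#)))
    (λ k → trans (p k) (sym (+-cong (*-congˡ (reflexive (insertAt-punchIn u j 0# k))) (reflexive (insertAt-punchIn v j 0# k)))))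

  insertAt-cong : ∀ {m} (j : Fin (suc m)) {u v : Vector Carrier m} → (∀ k → u k ≈ v k) →
    ∀ k → insertAt u j 0# k ≈ insertAt v j 0# k
  insertAt-cong j {u} {v} p = insertAt-≈ j u (reflexive (≡.sym (insertAt-lookup v j 0#)))
    (λ k → trans (p k) (reflexive (≡.sym (insertAt-punchIn v j 0# k))))

  insertColumn-alternating : ∀ {n m} {f : Matrix n (suc m) → Carrier} → IsAlternating f →
                             ∀ j → IsAlternating (f ∘ insertColumn j)
  insertColumn-alternating alt j = record
    { f-cong      = λ p → f-cong alt (λ i → insertAt-cong j (p i))
    ; linear      = λ i a p q r → linear alt i a (λ k k≢i → insertAt-cong j (p k k≢i))
                      (λ k k≢i → insertAt-cong j (q k k≢i)) (insertAt-linear j a r)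
    ; alternating = λ a p → alternating alt a (insertAt-cong j p)
    }

  -- After expanding the first row in unit vectors, the pivot column can be cleared
  -- below, which leaves alternating functions of the minors.
  alternating-unique : ∀ {n} {f : Matrix n n → Carrier} → IsAlternating f →
                       ∀ M → f M ≈ f 𝟙 * det M
  alternating-unique {zero}  alt M = trans (f-cong alt (λ ())) (sym (*-identityʳ _))
  alternating-unique {suc n} {f} alt M = begin
    f M
      ≈⟨ f-cong alt (◂-η M) ⟨
    f (M zero ◂ M′)
      ≈⟨ linear-expansion (λ u → f (u ◂ M′)) (λ p → f-cong alt (◂-cong p (λ _ _ → ≈-refl)))
           (λ a u v → linear-first alt a M′ (λ _ → ≈-refl)) (M zero) ⟩
    sum (λ j → M zero j * f (𝟙 j ◂ M′))
      ≈⟨ sum-cong-≋ (λ j → begin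
           M zero j * f (𝟙 j ◂ M′)                                ≈⟨ *-congˡ (clear j) ⟩
           M zero j * g j (minor M j)                             ≈⟨ *-congˡ (alternating-unique (alt-g j) (minor M j)) ⟩
           M zero j * (g j 𝟙 * det (minor M j))                   ≈⟨ *-congˡ (*-congʳ (g-𝟙 j)) ⟩
           M zero j * (sign (toℕ j) * f 𝟙 * det (minor M j))
             ≈⟨ solve 4 (λ x s t d → x :* (s :* t :* d) := t :* (s :* x :* d)) ≈-refl _ _ _ _ ⟩
           f 𝟙 * (sign (toℕ j) * M zero j * det (minor M j))      ∎) ⟩
    sum (λ j → f 𝟙 * (sign (toℕ j) * M zero j * det (minor M j)))
      ≈⟨ *-distribˡ-sum (f 𝟙) (λ j → sign (toℕ j) * M zero j * det (minor M j)) ⟨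
    f 𝟙 * det M ∎
    where
    M′ : Matrix n (suc n)
    M′ = M ∘ suc
    g : Fin (suc n) → Matrix n n → Carrier
    g j N = f (𝟙 j ◂ insertColumn j N)
    alt-g : ∀ j → IsAlternating (g j)
    alt-g j = insertColumn-alternating (fix-first alt (𝟙 j)) j
    clear : ∀ j → f (𝟙 j ◂ M′) ≈ g j (minor M j)
    clear j = begin
      f (𝟙 j ◂ M′)                                          ≈⟨ add-first-row alt (𝟙 j) (λ i → - M′ i j) M′ ⟨
      f (𝟙 j ◂ (λ i k → (- M′ i j) * 𝟙 j k + M′ i k))
        ≈⟨ f-cong alt (◂-cong (λ _ → ≈-refl) λ i k → sym (insertAt-≈ j (minor M j i) {λ k → (- M′ i j) * 𝟙 j k + M′ i k}
             (sym (trans (+-congʳ (trans (*-congˡ (reflexive (diagonal-≡ _ j))) (*-identityʳ _))) (-‿inverseˡ _)))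
             (λ k → sym (trans (+-congʳ (trans (*-congˡ (reflexive (diagonal-≢ _ (λ p → Fin.punchInᵢ≢i j k (≡.sym p))))) (zeroʳ _))) (+-identityˡ _)))
             k)) ⟩
      g j (minor M j)                                       ∎
    -- The unit row `𝟙 j` above the identity with a zero column inserted is the larger identity with
    -- its row `j` moved to the top, which explains the sign.
    g-𝟙 : ∀ j → g j 𝟙 ≈ sign (toℕ j) * f 𝟙
    g-𝟙 j = trans
      (f-cong alt (◂-cong (λ _ → ≈-refl) λ i → insertAt-≈ j (𝟙 i)
        (reflexive (≡.sym (diagonal-≢ _ (Fin.punchInᵢ≢i j i))))
        (λ k → reflexive (≡.sym (𝟙-punchIn j i k)))))
      (move-first alt j 𝟙)

  detᶜ-cong : ∀ {n} {M N : Matrix n n} → M ≋ N → detᶜ M ≈ detᶜ N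
  detᶜ-cong {zero}  p = ≈-refl
  detᶜ-cong {suc n} {M} {N} p = sum-cong-≋ {suc n} {λ i → sign (toℕ i) * M i zero * detᶜ (minorᶜ M i)} λ i →
    *-cong (*-congˡ (p i zero)) (detᶜ-cong (λ r k → p (punchIn i r) (suc k)))

  -- Row `i` enters each summand exactly once: as the entry in front when it is the deleted row, and
  -- inside the minor otherwise.
  detᶜ-linear : ∀ {n} i a {L M N : Matrix n n} →
                (∀ k → k ≢ i → ∀ j → L k j ≈ M k j) →
                (∀ k → k ≢ i → ∀ j → L k j ≈ N k j) →
                (∀ j → L i j ≈ a * M i j + N i j) →
                detᶜ L ≈ a * detᶜ M + detᶜ N
  detᶜ-linear {suc n} i a {L} {M} {N} p q r = sum-linear a term
    where
    term : ∀ l → sign (toℕ l) * L l zero * detᶜ (minorᶜ L l) ≈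
                 a * (sign (toℕ l) * M l zero * detᶜ (minorᶜ M l)) + sign (toℕ l) * N l zero * detᶜ (minorᶜ N l)
    term l with l Fin.≟ i
    ... | yes refl = begin
      sign (toℕ l) * L l zero * detᶜ (minorᶜ L l)
        ≈⟨ *-congʳ (*-congˡ (r zero)) ⟩
      sign (toℕ l) * (a * M l zero + N l zero) * detᶜ (minorᶜ L l)
        ≈⟨ solve 5 (λ s a m n d → s :* (a :* m :+ n) :* d := a :* (s :* m :* d) :+ s :* n :* d) ≈-refl _ a _ _ _ ⟩
      a * (sign (toℕ l) * M l zero * detᶜ (minorᶜ L l)) + sign (toℕ l) * N l zero * detᶜ (minorᶜ L l)
        ≈⟨ +-cong (*-congˡ (*-congˡ (detᶜ-cong λ s k → p _ (Fin.punchInᵢ≢i l s) (suc k))))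
                  (*-congˡ (detᶜ-cong λ s k → q _ (Fin.punchInᵢ≢i l s) (suc k))) ⟩
      a * (sign (toℕ l) * M l zero * detᶜ (minorᶜ M l)) + sign (toℕ l) * N l zero * detᶜ (minorᶜ N l) ∎
    ... | no l≢i = begin
      sign (toℕ l) * L l zero * detᶜ (minorᶜ L l)
        ≈⟨ *-congˡ (detᶜ-linear (punchOut l≢i) a
             (λ s s≢ k → p _ (s≢ ∘ away) (suc k)) (λ s s≢ k → q _ (s≢ ∘ away) (suc k))
             (λ k → ≡.subst (λ z → L z (suc k) ≈ a * M z (suc k) + N z (suc k)) (≡.sym (Fin.punchIn-punchOut l≢i)) (r (suc k)))) ⟩
      sign (toℕ l) * L l zero * (a * detᶜ (minorᶜ M l) + detᶜ (minorᶜ N l))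
        ≈⟨ solve 5 (λ s x a m n → s :* x :* (a :* m :+ n) := a :* (s :* x :* m) :+ s :* x :* n) ≈-refl _ _ a _ _ ⟩
      a * (sign (toℕ l) * L l zero * detᶜ (minorᶜ M l)) + sign (toℕ l) * L l zero * detᶜ (minorᶜ N l)
        ≈⟨ +-cong (*-congˡ (*-congʳ (*-congˡ (p l l≢i zero)))) (*-congʳ (*-congˡ (q l l≢i zero))) ⟩
      a * (sign (toℕ l) * M l zero * detᶜ (minorᶜ M l)) + sign (toℕ l) * N l zero * detᶜ (minorᶜ N l) ∎
      where
      away : ∀ {s} → punchIn l s ≡ i → s ≡ punchOut l≢i
      away e = Fin.punchIn-injective l _ _ (≡.trans e (≡.sym (Fin.punchIn-punchOut l≢i)))

  -- The summands of the two equal rows cancel because their signs are consecutive; every other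
  -- minor still contains both rows as neighbours and vanishes by induction.
  detᶜ-adjacent : ∀ {n} {i k} {M : Matrix n n} → Adjacent i k → (∀ j → M i j ≈ M k j) → detᶜ M ≈ 0#
  detᶜ-adjacent {suc n} {i} {k} {M} a p = sum-adjacent a pair others
    where
    same : ∀ r j → minorᶜ M i r j ≈ minorᶜ M k r j
    same r j with adjacent-punchIn a r
    ... | inj₁ e        = reflexive (cong (λ s → M s (suc j)) e)
    ... | inj₂ (e , e′) = trans (reflexive (cong (λ s → M s (suc j)) e))
                           (trans (sym (p (suc j))) (reflexive (cong (λ s → M s (suc j)) (≡.sym e′))))
    pair : sign (toℕ i) * M i zero * detᶜ (minorᶜ M i) + sign (toℕ k) * M k zero * detᶜ (minorᶜ M k) ≈ 0#
    pair = begin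
      sign (toℕ i) * M i zero * detᶜ (minorᶜ M i) + sign (toℕ k) * M k zero * detᶜ (minorᶜ M k)
        ≈⟨ +-cong (*-cong (*-congˡ (p zero)) (detᶜ-cong same)) (*-congʳ (*-congʳ (reflexive (cong sign (adjacent-toℕ a))))) ⟩
      sign (toℕ i) * M k zero * detᶜ (minorᶜ M k) + (- sign (toℕ i)) * M k zero * detᶜ (minorᶜ M k)
        ≈⟨ solve 3 (λ s x d → s :* x :* d :+ (:- s) :* x :* d := con (+ 0)) ≈-refl _ _ _ ⟩
      0# ∎
    others : ∀ l → l ≢ i → l ≢ k → sign (toℕ l) * M l zero * detᶜ (minorᶜ M l) ≈ 0#
    others l l≢i l≢k =
      let (i′ , k′ , a′ , e , e′) = adjacent-punchOut a l≢i l≢k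
      in trans (*-congˡ (detᶜ-adjacent a′ (λ j → trans (reflexive (cong (λ s → M s (suc j)) e))
                 (trans (p (suc j)) (reflexive (cong (λ s → M s (suc j)) (≡.sym e′)))))))
               (zeroʳ _)

  detᶜ-alternating : ∀ {n} → IsAlternating (detᶜ {n})
  detᶜ-alternating = record
    { f-cong      = detᶜ-cong
    ; linear      = detᶜ-linear
    ; alternating = detᶜ-adjacent
    }

  ∏ : ∀ {n} → Vector Carrier n → Carrier
  ∏ {zero}  d = 1#
  ∏ {suc n} d = d zero * ∏ (d ∘ suc)

  ∏-1 : ∀ n → ∏ {n} (λ _ → 1#) ≈ 1#
  ∏-1 zero    = ≈-refl
  ∏-1 (suc n) = trans (*-identityˡ _) (∏-1 n)

  detᶜ-diagonal : ∀ {n} (d : Vector Carrier n) → detᶜ (diagonal d) ≈ ∏ d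
  detᶜ-diagonal {zero}  d = ≈-refl
  detᶜ-diagonal {suc n} d = begin
    1# * d zero * detᶜ (diagonal (d ∘ suc)) + sum (λ i → - sign (toℕ i) * 0# * detᶜ (minorᶜ (diagonal d) (suc i)))
      ≈⟨ +-cong (*-cong (*-identityˡ _) (detᶜ-diagonal (d ∘ suc)))
                (sum-zero (λ i → - sign (toℕ i) * 0# * detᶜ (minorᶜ (diagonal d) (suc i))) λ i → trans (*-congʳ (zeroʳ _)) (zeroˡ _)) ⟩
    d zero * ∏ (d ∘ suc) + 0#
      ≈⟨ +-identityʳ _ ⟩
    ∏ d ∎

  -- Uniqueness applied to `detᶜ`, which takes the value 1 at the identity. Through it everything
  -- proved for the column expansion passes to the row expansion.
  detᶜ≈det : ∀ {n} (M : Matrix n n) → detᶜ M ≈ det M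
  detᶜ≈det {n} M = begin
    detᶜ M           ≈⟨ alternating-unique detᶜ-alternating M ⟩
    detᶜ {n} 𝟙 * det M ≈⟨ *-congʳ (trans (detᶜ-diagonal {n} (λ _ → 1#)) (∏-1 n)) ⟩
    1# * det M       ≈⟨ *-identityˡ _ ⟩
    det M            ∎

  det-cong : ∀ {n} {M N : Matrix n n} → M ≋ N → det M ≈ det N
  det-cong {M = M} {N} p = trans (sym (detᶜ≈det M)) (trans (detᶜ-cong p) (detᶜ≈det N))

  det-diagonal : ∀ {n} (d : Vector Carrier n) → det (diagonal d) ≈ ∏ d
  det-diagonal d = trans (sym (detᶜ≈det (diagonal d))) (detᶜ-diagonal d)

  ⊗-alternating : ∀ {n m l} {f : Matrix n l → Carrier} → IsAlternating f →
                  ∀ (P : Matrix m l) → IsAlternating (λ M → f (M ⊗ P))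
  ⊗-alternating alt P = record
    { f-cong      = λ p → f-cong alt (λ i k → sum-cong-≋ λ j → *-congʳ (p i j))
    ; linear      = λ i a p q r → linear alt i a
        (λ s s≢i k → sum-cong-≋ λ j → *-congʳ (p s s≢i j))
        (λ s s≢i k → sum-cong-≋ λ j → *-congʳ (q s s≢i j))
        (λ k → sum-linear a λ j → trans (*-congʳ (r j)) (trans (distribʳ _ _ _) (+-congʳ (*-assoc _ _ _))))
    ; alternating = λ a p → alternating alt a (λ k → sum-cong-≋ λ j → *-congʳ (p j))
    }

  -- For fixed `P` the value at `M ⊗ P` is an alternating form in the rows of `M`, hence a multiple
  -- of `det M`; the factor is its value at the identity.
  det-⊗ : ∀ {n} (M P : Matrix n n) → det (M ⊗ P) ≈ det M * det P
  det-⊗ M P = begin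
    det (M ⊗ P)               ≈⟨ detᶜ≈det (M ⊗ P) ⟨
    detᶜ (M ⊗ P)              ≈⟨ alternating-unique (⊗-alternating detᶜ-alternating P) M ⟩
    detᶜ (𝟙 ⊗ P) * det M      ≈⟨ *-congʳ (detᶜ-cong λ i k → trans (sum-diagonalˡ _ (λ j → P j k) i) (*-identityˡ _)) ⟩
    detᶜ P * det M            ≈⟨ *-congʳ (detᶜ≈det P) ⟩
    det P * det M             ≈⟨ *-comm _ _ ⟩
    det M * det P             ∎

-- Eigenvectors of the adjacency matrix

module Tables where
  open import Agda.Builtin.FromNat using (fromNat)
  open import Agda.Builtin.FromNeg using (fromNeg)
  instance
    ℤ-number   = Literals.number
    ℤ-negative = Literals.negative

  -- The modulus of 1 + ω^k + ω^(-k+3l) in row k and column l.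
  eigenvalue : Vec (Vec ℤ _) _
  eigenvalue = (3 ∷ 1 ∷ []) ∷ (2 ∷ 2 ∷ []) ∷ (0 ∷ 2 ∷ []) ∷ (1 ∷ 1 ∷ []) ∷ (0 ∷ 2 ∷ []) ∷ (2 ∷ 2 ∷ []) ∷ []

  -- Joint eigenvectors of all Jucys-Murphy elements acting from the left and from the
  -- right, hence pairwise orthogonal; the sum of the three transpositions is one of these.
  eigenvectors : Vec (Vec ℤ _) _
  eigenvectors =
    ( 1 ∷  1 ∷  1 ∷  1 ∷  1 ∷  1 ∷  1 ∷  1 ∷  1 ∷  1 ∷  1 ∷  1 ∷  1 ∷  1 ∷  1 ∷  1 ∷  1 ∷  1 ∷  1 ∷  1 ∷  1 ∷  1 ∷  1 ∷  1 ∷ []) ∷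
    ( 1 ∷ -1 ∷ -1 ∷  1 ∷  1 ∷ -1 ∷ -1 ∷  1 ∷  1 ∷ -1 ∷ -1 ∷  1 ∷  1 ∷ -1 ∷ -1 ∷  1 ∷  1 ∷ -1 ∷ -1 ∷  1 ∷  1 ∷ -1 ∷ -1 ∷  1 ∷ []) ∷
    ( 0 ∷  0 ∷  0 ∷ -1 ∷  0 ∷  1 ∷  0 ∷  0 ∷  0 ∷ -1 ∷  0 ∷  1 ∷  0 ∷  1 ∷  0 ∷  1 ∷ -1 ∷ -1 ∷  0 ∷ -1 ∷  0 ∷ -1 ∷  1 ∷  1 ∷ []) ∷
    (-3 ∷  1 ∷ -3 ∷  1 ∷  1 ∷  1 ∷ -3 ∷  1 ∷ -3 ∷  1 ∷  1 ∷  1 ∷ -3 ∷  1 ∷ -3 ∷  1 ∷  1 ∷  1 ∷  1 ∷  1 ∷  1 ∷  1 ∷  1 ∷  1 ∷ []) ∷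
    ( 0 ∷ -2 ∷  0 ∷ -2 ∷  1 ∷  1 ∷  0 ∷ -2 ∷  0 ∷ -2 ∷  1 ∷  1 ∷  0 ∷ -2 ∷  0 ∷ -2 ∷  1 ∷  1 ∷  1 ∷  1 ∷  1 ∷  1 ∷  1 ∷  1 ∷ []) ∷
    (-2 ∷  2 ∷  1 ∷ -1 ∷ -1 ∷  1 ∷ -2 ∷  2 ∷  1 ∷ -1 ∷ -1 ∷  1 ∷  1 ∷ -1 ∷  1 ∷ -1 ∷  0 ∷  0 ∷ -1 ∷  1 ∷ -1 ∷  1 ∷  0 ∷  0 ∷ []) ∷
    (-6 ∷ -2 ∷  3 ∷  1 ∷  1 ∷ -5 ∷ -6 ∷ -2 ∷  3 ∷  1 ∷  1 ∷ -5 ∷  3 ∷  1 ∷  3 ∷  1 ∷  4 ∷  4 ∷  1 ∷ -5 ∷  1 ∷ -5 ∷  4 ∷  4 ∷ []) ∷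
    ( 0 ∷  0 ∷ -3 ∷  3 ∷  1 ∷ -1 ∷  0 ∷  0 ∷  3 ∷ -3 ∷ -1 ∷  1 ∷ -3 ∷  3 ∷  3 ∷ -3 ∷ -2 ∷  2 ∷  1 ∷ -1 ∷ -1 ∷  1 ∷ -2 ∷  2 ∷ []) ∷
    ( 2 ∷  2 ∷ -1 ∷ -1 ∷ -1 ∷ -1 ∷  2 ∷  2 ∷ -1 ∷ -1 ∷ -1 ∷ -1 ∷ -1 ∷ -1 ∷ -1 ∷ -1 ∷  2 ∷  2 ∷ -1 ∷ -1 ∷ -1 ∷ -1 ∷  2 ∷  2 ∷ []) ∷
    ( 0 ∷  0 ∷  1 ∷  1 ∷ -1 ∷ -1 ∷  0 ∷  0 ∷ -1 ∷ -1 ∷  1 ∷  1 ∷  1 ∷  1 ∷ -1 ∷ -1 ∷  0 ∷  0 ∷ -1 ∷ -1 ∷  1 ∷  1 ∷  0 ∷  0 ∷ []) ∷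
    ( 0 ∷  0 ∷  3 ∷  1 ∷  3 ∷  1 ∷  0 ∷  0 ∷ -3 ∷ -1 ∷ -3 ∷ -1 ∷  3 ∷  1 ∷ -3 ∷ -1 ∷ -2 ∷  2 ∷  3 ∷  1 ∷ -3 ∷ -1 ∷ -2 ∷  2 ∷ []) ∷
    ( 0 ∷  0 ∷  0 ∷  0 ∷ -1 ∷  1 ∷  0 ∷  0 ∷  0 ∷  0 ∷  1 ∷ -1 ∷  0 ∷  0 ∷  0 ∷  0 ∷ -1 ∷  1 ∷ -1 ∷  1 ∷  1 ∷ -1 ∷ -1 ∷  1 ∷ []) ∷
    ( 0 ∷  2 ∷  0 ∷  1 ∷ -2 ∷ -1 ∷  0 ∷ -2 ∷  0 ∷ -1 ∷  2 ∷  1 ∷  0 ∷ -1 ∷  0 ∷  1 ∷  1 ∷ -1 ∷  2 ∷  1 ∷ -2 ∷ -1 ∷ -1 ∷  1 ∷ []) ∷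
    ( 0 ∷ -2 ∷  0 ∷  1 ∷ -2 ∷  1 ∷  0 ∷ -2 ∷  0 ∷  1 ∷ -2 ∷  1 ∷  0 ∷  1 ∷  0 ∷  1 ∷  1 ∷  1 ∷ -2 ∷  1 ∷ -2 ∷  1 ∷  1 ∷  1 ∷ []) ∷
    (-3 ∷ -1 ∷  3 ∷  1 ∷  1 ∷ -1 ∷  3 ∷  1 ∷ -3 ∷ -1 ∷ -1 ∷  1 ∷ -3 ∷ -1 ∷  3 ∷  1 ∷  1 ∷ -1 ∷ -1 ∷  1 ∷  1 ∷ -1 ∷ -1 ∷  1 ∷ []) ∷
    ( 0 ∷  0 ∷  0 ∷ -1 ∷  0 ∷ -1 ∷  0 ∷  0 ∷  0 ∷  1 ∷  0 ∷  1 ∷  0 ∷ -1 ∷  0 ∷  1 ∷ -1 ∷  1 ∷  0 ∷ -1 ∷  0 ∷  1 ∷ -1 ∷  1 ∷ []) ∷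
    ( 0 ∷  0 ∷  1 ∷ -1 ∷  1 ∷ -1 ∷  0 ∷  0 ∷  1 ∷ -1 ∷  1 ∷ -1 ∷ -1 ∷  1 ∷ -1 ∷  1 ∷  0 ∷  0 ∷ -1 ∷  1 ∷ -1 ∷  1 ∷  0 ∷  0 ∷ []) ∷
    ( 2 ∷ -2 ∷  1 ∷ -1 ∷ -1 ∷  1 ∷ -2 ∷  2 ∷ -1 ∷  1 ∷  1 ∷ -1 ∷ -1 ∷  1 ∷  1 ∷ -1 ∷  2 ∷ -2 ∷  1 ∷ -1 ∷ -1 ∷  1 ∷ -2 ∷  2 ∷ []) ∷
    ( 0 ∷  0 ∷  0 ∷  0 ∷ -1 ∷ -1 ∷  0 ∷  0 ∷  0 ∷  0 ∷ -1 ∷ -1 ∷  0 ∷  0 ∷  0 ∷  0 ∷ -1 ∷ -1 ∷  1 ∷  1 ∷  1 ∷  1 ∷  1 ∷  1 ∷ []) ∷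
    ( 0 ∷  0 ∷ -3 ∷  1 ∷  3 ∷ -1 ∷  0 ∷  0 ∷ -3 ∷  1 ∷  3 ∷ -1 ∷  3 ∷ -1 ∷  3 ∷ -1 ∷ -2 ∷ -2 ∷ -3 ∷  1 ∷ -3 ∷  1 ∷  2 ∷  2 ∷ []) ∷
    ( 0 ∷  0 ∷  3 ∷  3 ∷  1 ∷  1 ∷  0 ∷  0 ∷  3 ∷  3 ∷  1 ∷  1 ∷ -3 ∷ -3 ∷ -3 ∷ -3 ∷ -2 ∷ -2 ∷ -1 ∷ -1 ∷ -1 ∷ -1 ∷  2 ∷  2 ∷ []) ∷
    (-6 ∷  2 ∷ -3 ∷  1 ∷  1 ∷  5 ∷  6 ∷ -2 ∷  3 ∷ -1 ∷ -1 ∷ -5 ∷  3 ∷ -1 ∷ -3 ∷  1 ∷  4 ∷ -4 ∷ -1 ∷ -5 ∷  1 ∷  5 ∷ -4 ∷  4 ∷ []) ∷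
    ( 2 ∷  2 ∷  1 ∷  1 ∷  1 ∷  1 ∷ -2 ∷ -2 ∷ -1 ∷ -1 ∷ -1 ∷ -1 ∷ -1 ∷ -1 ∷  1 ∷  1 ∷  0 ∷  0 ∷ -1 ∷ -1 ∷  1 ∷  1 ∷  0 ∷  0 ∷ []) ∷
    ( 0 ∷  2 ∷  0 ∷ -2 ∷  1 ∷ -1 ∷  0 ∷ -2 ∷  0 ∷  2 ∷ -1 ∷  1 ∷  0 ∷  2 ∷  0 ∷ -2 ∷  1 ∷ -1 ∷ -1 ∷  1 ∷  1 ∷ -1 ∷ -1 ∷  1 ∷ []) ∷ []

Index : Set
Index = Fin 6 × Fin 2

indices : List Index
indices = cartesianProduct (allFin 6) (allFin 2)

eigenvalue : Index → ℤ
eigenvalue (k , l) = Vec.lookup (Vec.lookup Tables.eigenvalue k) l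

-- The order is tied to the table of eigenvectors: row `i` there belongs to entry `i` here, so two
-- consecutive rows belong to a value and its negative.
eigenvalues : List ℤ
eigenvalues = concatMap (λ kl → eigenvalue kl ∷ ℤ.- eigenvalue kl ∷ []) indices

eigenvector : Fin 24 → Fin 24 → ℤ
eigenvector i = Vec.lookup (Vec.lookup Tables.eigenvectors i)

-- Edges as booleans can be read as 0 and 1 both in ℤ, for evaluation, and in the reals, where they
-- give the adjacency matrix.
adjacent : ∀ {v ℓ a} (Γ : FiniteSimpleGraph v ℓ a) → (i j : Fin (FiniteSimpleGraph.order Γ)) → Bool
adjacent Γ i j = does (vertex i ~? vertex j)
  where open FiniteSimpleGraph Γ

sumℤ : ∀ {n} → (Fin n → ℤ) → ℤ
sumℤ = Vector.foldr ℤ._+_ (+ 0)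

eigenvector-adjacency : ∀ i j →
  sumℤ (λ k → eigenvector i k ℤ.* (if adjacent X₃ k j then + 1 else + 0)) ≡ List.lookup eigenvalues i ℤ.* eigenvector i j
eigenvector-adjacency = from-yes (Fin.all? λ i → Fin.all? λ j →
  sumℤ (λ k → eigenvector i k ℤ.* (if adjacent X₃ k j then + 1 else + 0)) ℤ.≟ (List.lookup eigenvalues i ℤ.* eigenvector i j))

eigenvector-orthogonal : ∀ i j → i ≡ j ⊎ sumℤ (λ k → eigenvector i k ℤ.* eigenvector j k) ≡ + 0
eigenvector-orthogonal = from-yes (Fin.all? λ i → Fin.all? λ j → (i Fin.≟ j) ⊎-dec (sumℤ (λ k → eigenvector i k ℤ.* eigenvector j k) ℤ.≟ + 0))

eigenvector-nonzero : ∀ i → sumℤ (λ k → eigenvector i k ℤ.* eigenvector i k) ≢ + 0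
eigenvector-nonzero = from-yes (Fin.all? λ i → ¬? (sumℤ (λ k → eigenvector i k ℤ.* eigenvector i k) ℤ.≟ + 0))

-- The characteristic polynomial from an orthogonal integral eigenbasis

module CharacteristicPolynomial {c ℓ₁ ℓ₂ ℓ₃} (ℝ : RealNumbers c ℓ₁ ℓ₂ ℓ₃) where
  open RealNumbers ℝ hiding (zero) renaming (refl to ≈-refl)
  open CommutativeRing commutativeRing using (semiring)
  open Integers commutativeRing
  open Solver using (solve; _:=_; _:+_; _:*_; :-_; _:-_; con)
  open Determinants commutativeRing
  open Spectrum ℝ using (scalar; charPoly; HasSpectrum) renaming (det to laplace)
  open import Algebra.Properties.Semiring.Sum semiring using (sum; sum-cong-≋)
  open import Relation.Binary.Reasoning.Setoid setoid

  sign-unique : ∀ (s : ℕ → Carrier) → s 0 ≡ 1# → (∀ k → s (suc k) ≡ - s k) → ∀ k → s k ≡ sign k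
  sign-unique s p q zero    = p
  sign-unique s p q (suc k) = ≡.trans (q k) (cong -_ (sign-unique s p q k))

  tailOf : ∀ {n x y} {f : Fin n → Carrier} → x ≡ sum (y ◂ f) → Fin n → Carrier
  tailOf {f = f} _ = f

  -- The sign in the definition of the determinant is local to it, so the
  -- summands are recovered by unification and the sign by its recursion.
  laplace-tail : ∀ {n} (M : Matrix (suc n) (suc n)) i →
    tailOf {x = laplace M} refl i ≡ sign (suc (toℕ i)) * M zero (suc i) * laplace (minor M (suc i))
  laplace-tail M i with toℕ i | sign-unique _ refl (λ _ → refl)
  ... | k | unique = cong (λ s → - s * _ * _) (unique k)

  laplace≈det : ∀ {n} (M : Matrix n n) → laplace M ≈ det M
  laplace≈det {zero}  M = ≈-refl
  laplace≈det {suc n} M = +-cong (*-congˡ (laplace≈det (minor M zero)))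
    (sum-cong-≋ {n} {tailOf {x = laplace M} refl} λ i → trans (reflexive (laplace-tail M i)) (*-congˡ (laplace≈det (minor M (suc i)))))

  scalar≈diagonal : ∀ {n} x (i j : Fin n) → scalar x i j ≈ diagonal (λ _ → x) i j
  scalar≈diagonal x i j with i Fin.≟ j
  ... | yes refl = sym (reflexive (diagonal-≡ (λ _ → x) i))
  ... | no i≢j   = sym (reflexive (diagonal-≢ (λ _ → x) i≢j))

  ∏-invertible : ∀ {n} {s : Fin n → Carrier} → (∀ i → ∃[ y ] y * s i ≈ 1#) → ∃[ y ] y * ∏ s ≈ 1#
  ∏-invertible {zero}  p = 1# , *-identityˡ 1#
  ∏-invertible {suc n} p =
    let (y , q) = p zero
        (z , r) = ∏-invertible (p ∘ suc)
    in y * z , trans (solve 4 (λ y z a b → y :* z :* (a :* b) := y :* a :* (z :* b)) ≈-refl _ _ _ _)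
                     (trans (*-cong q r) (*-identityˡ 1#))

  -- By `orthogonal`, `det P * det Pᵀ` is the product of the `s i`, hence invertible. Multiplying by
  -- its inverse cancels `det P` from `det P * det B ≈ det E * det P`, and no inverse matrix has to
  -- be found.
  charPoly-diagonalised : ∀ {n} (A P : Matrix n n) (d s : Fin n → Carrier) →
    (∀ i j → sum (λ k → P i k * A k j) ≈ d i * P i j) →
    (∀ i j → sum (λ k → P i k * P j k) ≈ diagonal s i j) →
    (∀ i → ∃[ y ] y * s i ≈ 1#) →
    ∀ x → charPoly A x ≈ ∏ (λ i → x - d i)
  charPoly-diagonalised {n} A P d s eigen orthogonal invertible x =
    let (y , q) = ∏-invertible invertible in begin
    charPoly A x                                    ≈⟨ laplace≈det B ⟩
    det B                                           ≈⟨ *-identityˡ _ ⟨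
    1# * det B                                      ≈⟨ *-congʳ (trans (*-congˡ det-P²) q) ⟨
    y * (det P * det Pᵀ) * det B                    ≈⟨ solve 4 (λ y p q b → y :* (p :* q) :* b := y :* q :* (p :* b)) ≈-refl _ _ _ _ ⟩
    y * det Pᵀ * (det P * det B)                    ≈⟨ *-congˡ (trans (sym (det-⊗ P B)) (trans (det-cong PB≋EP) (det-⊗ E P))) ⟩
    y * det Pᵀ * (det E * det P)                    ≈⟨ solve 4 (λ y p q e → y :* q :* (e :* p) := y :* (p :* q) :* e) ≈-refl _ _ _ _ ⟩
    y * (det P * det Pᵀ) * det E                    ≈⟨ *-congʳ (trans (*-congˡ det-P²) q) ⟩
    1# * det E                                      ≈⟨ *-identityˡ _ ⟩
    det E                                           ≈⟨ det-diagonal (λ i → x - d i) ⟩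
    ∏ (λ i → x - d i)                               ∎
    where
    B Pᵀ E : Matrix n n
    B i j  = scalar x i j - A i j
    Pᵀ i j = P j i
    E      = diagonal (λ i → x - d i)
    det-P² : det P * det Pᵀ ≈ ∏ s
    det-P² = trans (sym (det-⊗ P Pᵀ)) (trans (det-cong orthogonal) (det-diagonal s))
    PB≋EP : (P ⊗ B) ≋ (E ⊗ P)
    PB≋EP i j = begin
      sum (λ k → P i k * (scalar x k j - A k j))
        -- The coefficient -1 in front brings the summand to the shape required by `sum-linear`.
        ≈⟨ sum-cong-≋ {n} {λ k → P i k * (scalar x k j - A k j)} (λ k → trans (*-congˡ (+-congʳ (scalar≈diagonal x k j)))
             (solve 3 (λ p d a → p :* (d :- a) := con -[1+ 0 ] :* (p :* a) :+ p :* d) ≈-refl (P i k) _ _)) ⟩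
      sum (λ k → ⟦ -[1+ 0 ] ⟧ * (P i k * A k j) + P i k * diagonal (λ _ → x) k j)
        ≈⟨ sum-linear ⟦ -[1+ 0 ] ⟧ {y = λ k → P i k * A k j} (λ _ → ≈-refl) ⟩
      ⟦ -[1+ 0 ] ⟧ * sum (λ k → P i k * A k j) + sum (λ k → P i k * diagonal (λ _ → x) k j)
        ≈⟨ +-cong (*-congˡ (eigen i j)) (sum-diagonalʳ (λ _ → x) (P i) j) ⟩
      ⟦ -[1+ 0 ] ⟧ * (d i * P i j) + P i j * x
        ≈⟨ solve 3 (λ p d x → con -[1+ 0 ] :* (d :* p) :+ p :* x := (x :- d) :* p) ≈-refl _ _ _ ⟩
      (x - d i) * P i j
        ≈⟨ sum-diagonalˡ (λ i → x - d i) (λ k → P k j) i ⟨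
      sum (λ k → E i k * P k j) ∎

  ⟦⟧-sum : ∀ {n} (f : Fin n → ℤ) → ⟦ sumℤ f ⟧ ≈ sum (⟦_⟧ ∘ f)
  ⟦⟧-sum {zero}  f = ≈-refl
  ⟦⟧-sum {suc n} f = trans (⟦⟧-+ (f zero) _) (+-congˡ (⟦⟧-sum (f ∘ suc)))

  ⟦⟧-dot : ∀ {n} (f g : Fin n → ℤ) → sum (λ k → ⟦ f k ⟧ * ⟦ g k ⟧) ≈ ⟦ sumℤ (λ k → f k ℤ.* g k) ⟧
  ⟦⟧-dot f g = trans (sum-cong-≋ (λ k → sym (⟦⟧-* (f k) (g k)))) (sym (⟦⟧-sum (λ k → f k ℤ.* g k)))

  ⟦⟧-invertible : ∀ i → i ≢ + 0 → ∃[ y ] y * ⟦ i ⟧ ≈ 1#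
  ⟦⟧-invertible (+ zero)  i≢0 = ⊥-elim (i≢0 refl)
  ⟦⟧-invertible (+ suc n) _   = 1/ (suc n) , trans (*-comm _ _) (1/-inverse (suc n))
  ⟦⟧-invertible -[1+ n ]  _   = - 1/ (suc n) ,
    trans (solve 2 (λ y i → (:- y) :* (:- i) := i :* y) ≈-refl _ _) (1/-inverse (suc n))

  ⟦⟧-indicator : ∀ b → (if b then 1# else 0#) ≈ ⟦ if b then + 1 else + 0 ⟧
  ⟦⟧-indicator true  = sym ⟦⟧-1
  ⟦⟧-indicator false = ≈-refl

  ∏ᴸ : Carrier → List Carrier → Carrier
  ∏ᴸ x = List.foldr (λ λₖ p → (x - λₖ) * p) 1#

  ∏-lookup : ∀ x (is : List ℤ) → ∏ (λ i → x - ⟦ List.lookup is i ⟧) ≈ ∏ᴸ x (List.map ⟦_⟧ is)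
  ∏-lookup x []       = ≈-refl
  ∏-lookup x (i ∷ is) = *-congˡ (∏-lookup x is)

  ∏-± : ∀ {k} {K : Set k} x (r : K → Carrier) (d : K → ℤ) → (∀ k → r k * r k ≈ ⟦ d k ℤ.* d k ⟧) → ∀ ks →
        ∏ᴸ x (List.map ⟦_⟧ (concatMap (λ k → d k ∷ ℤ.- d k ∷ []) ks)) ≈
        ∏ᴸ x (concatMap (λ k → r k ∷ - r k ∷ []) ks)
  ∏-± x r d p []       = ≈-refl
  ∏-± x r d p (k ∷ ks) = begin
    (x - ⟦ d k ⟧) * ((x - ⟦ ℤ.- d k ⟧) * P)       ≈⟨ *-congˡ (*-congʳ (+-congˡ (-‿cong (⟦⟧-neg (d k))))) ⟩
    (x - ⟦ d k ⟧) * ((x - - ⟦ d k ⟧) * P)         ≈⟨ difference-of-squares ⟦ d k ⟧ P ⟩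
    (x * x - ⟦ d k ⟧ * ⟦ d k ⟧) * P               ≈⟨ *-cong (+-congˡ (-‿cong (trans (sym (⟦⟧-* (d k) (d k))) (sym (p k))))) (∏-± x r d p ks) ⟩
    (x * x - r k * r k) * Q                       ≈⟨ difference-of-squares (r k) Q ⟨
    (x - r k) * ((x - - r k) * Q)                 ∎
    where
    P = ∏ᴸ x (List.map ⟦_⟧ (concatMap (λ k → d k ∷ ℤ.- d k ∷ []) ks))
    Q = ∏ᴸ x (concatMap (λ k → r k ∷ - r k ∷ []) ks)
    difference-of-squares : ∀ a p → (x - a) * ((x - - a) * p) ≈ (x * x - a * a) * p
    difference-of-squares a p = solve 3 (λ x a p → (x :- a) :* ((x :- :- a) :* p) := (x :* x :- a :* a) :* p) ≈-refl x a p

  charPoly-integral : ∀ {n} (a : Fin n → Fin n → Bool) (P : Fin n → Fin n → ℤ) (d : Fin n → ℤ) →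
    (∀ i j → sumℤ (λ k → P i k ℤ.* (if a k j then + 1 else + 0)) ≡ d i ℤ.* P i j) →
    (∀ i j → i ≡ j ⊎ sumℤ (λ k → P i k ℤ.* P j k) ≡ + 0) →
    (∀ i → sumℤ (λ k → P i k ℤ.* P i k) ≢ + 0) →
    ∀ x → charPoly (λ i j → if a i j then 1# else 0#) x ≈ ∏ (λ i → x - ⟦ d i ⟧)
  charPoly-integral {n} a P d eigen orthogonal nonzero =
    charPoly-diagonalised (λ i j → if a i j then 1# else 0#) (λ i j → ⟦ P i j ⟧) (λ i → ⟦ d i ⟧) (λ i → ⟦ s i ⟧)
      eigen′ orthogonal′ (λ i → ⟦⟧-invertible (s i) (nonzero i))
    where
    s : Fin n → ℤ
    s i = sumℤ (λ k → P i k ℤ.* P i k)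
    eigen′ : ∀ i j → sum (λ k → ⟦ P i k ⟧ * (if a k j then 1# else 0#)) ≈ ⟦ d i ⟧ * ⟦ P i j ⟧
    eigen′ i j = begin
      sum (λ k → ⟦ P i k ⟧ * (if a k j then 1# else 0#))
        ≈⟨ sum-cong-≋ {n} {λ k → ⟦ P i k ⟧ * (if a k j then 1# else 0#)} (λ k → *-congˡ (⟦⟧-indicator (a k j))) ⟩
      sum (λ k → ⟦ P i k ⟧ * ⟦ if a k j then + 1 else + 0 ⟧)
        ≈⟨ ⟦⟧-dot (P i) (λ k → if a k j then + 1 else + 0) ⟩
      ⟦ sumℤ (λ k → P i k ℤ.* (if a k j then + 1 else + 0)) ⟧
        ≡⟨ cong ⟦_⟧ (eigen i j) ⟩
      ⟦ d i ℤ.* P i j ⟧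
        ≈⟨ ⟦⟧-* (d i) (P i j) ⟩
      ⟦ d i ⟧ * ⟦ P i j ⟧ ∎
    orthogonal′ : ∀ i j → sum (λ k → ⟦ P i k ⟧ * ⟦ P j k ⟧) ≈ diagonal (λ i → ⟦ s i ⟧) i j
    orthogonal′ i j with i Fin.≟ j | orthogonal i j
    ... | yes refl | _        = trans (⟦⟧-dot (P i) (P i)) (reflexive (≡.sym (diagonal-≡ _ i)))
    ... | no i≢j   | inj₁ i≡j = ⊥-elim (i≢j i≡j)
    ... | no i≢j   | inj₂ q   = trans (⟦⟧-dot (P i) (P j)) (trans (reflexive (cong ⟦_⟧ q)) (reflexive (≡.sym (diagonal-≢ _ i≢j))))


  integral-spectrum : ∀ {v ℓ a} (Γ : FiniteSimpleGraph v ℓ a) →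
    let open FiniteSimpleGraph Γ using (order) in
    (P : Fin order → Fin order → ℤ) (d : Fin order → ℤ) →
    (∀ i j → sumℤ (λ k → P i k ℤ.* (if adjacent Γ k j then + 1 else + 0)) ≡ d i ℤ.* P i j) →
    (∀ i j → i ≡ j ⊎ sumℤ (λ k → P i k ℤ.* P j k) ≡ + 0) →
    (∀ i → sumℤ (λ k → P i k ℤ.* P i k) ≢ + 0) →
    ∀ λs → (∀ x → ∏ (λ i → x - ⟦ d i ⟧) ≈ ∏ᴸ x λs) → HasSpectrum Γ λs
  integral-spectrum Γ P d eigen orthogonal nonzero λs factor x =
    trans (charPoly-integral (adjacent Γ) P d eigen orthogonal nonzero x) (factor x)

  X₃-spectrum : (r : Index → Carrier) → (∀ kl → r kl * r kl ≈ ⟦ eigenvalue kl ℤ.* eigenvalue kl ⟧) →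
                HasSpectrum X₃ (concatMap (λ kl → r kl ∷ - r kl ∷ []) indices)
  X₃-spectrum r p = integral-spectrum X₃ eigenvector (List.lookup eigenvalues)
    eigenvector-adjacency eigenvector-orthogonal eigenvector-nonzero (concatMap (λ kl → r kl ∷ - r kl ∷ []) indices)
    (λ x → trans (∏-lookup x eigenvalues) (∏-± x r eigenvalue p indices))

-- Order and limits

module Limits {c ℓ₁ ℓ₂ ℓ₃} (ℝ : RealNumbers c ℓ₁ ℓ₂ ℓ₃) where
  open RealNumbers ℝ hiding (zero) renaming (refl to ≈-refl)
  open Integers commutativeRing
  open Solver using (solve; _:=_; _:+_; _:*_; :-_; _:-_; con)
  private module < = IsStrictPartialOrder isStrictPartialOrder

  open import Relation.Binary.Reasoning.Setoid setoid

  <-cong : ∀ {x x′ y y′} → x ≈ x′ → y ≈ y′ → x < y → x′ < y′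
  <-cong p q x<y = <.<-respˡ-≈ p (<.<-respʳ-≈ q x<y)

  <⇒0<- : ∀ {x y} → x < y → 0# < y - x
  <⇒0<- {x} x<y = <-cong (-‿inverseʳ x) ≈-refl (+-monoˡ-< (- x) x<y)

  0<⇒< : ∀ {x y d} → 0# < d → d ≈ y - x → x < y
  0<⇒< {x} {y} {d} 0<d p = <-cong (+-identityˡ x)
    (trans (+-congʳ p) (solve 2 (λ x y → y :- x :+ x := y) ≈-refl x y)) (+-monoˡ-< x 0<d)

  +-mono-< : ∀ {x y u v} → x < y → u < v → x + u < y + v
  +-mono-< {x} {y} {u} {v} x<y u<v =
    <.trans (+-monoˡ-< u x<y) (<-cong (+-comm u y) (+-comm v y) (+-monoˡ-< y u<v))

  +-pos : ∀ {x y} → 0# < x → 0# < y → 0# < x + y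
  +-pos 0<x 0<y = <-cong (+-identityʳ 0#) ≈-refl (+-mono-< 0<x 0<y)

  0<1 : 0# < 1#
  0<1 with #⇒< (1#0 (HeytingField.heytingCommutativeRing heytingField))
  ... | inj₂ 0<1 = 0<1
  ... | inj₁ 1<0 = <-cong ≈-refl
    (trans (solve 1 (λ x → (con (+ 0) :- x) :* (con (+ 0) :- x) := x :* x) ≈-refl 1#) (*-identityˡ 1#))
    (*-pos (<⇒0<- 1<0) (<⇒0<- 1<0))

  0<fromℕ : ∀ n → 0# < fromℕ (suc n)
  0<fromℕ zero    = <-cong ≈-refl (sym (+-identityʳ 1#)) 0<1
  0<fromℕ (suc n) = +-pos 0<1 (0<fromℕ n)

  0<⇒invertible : ∀ {x} → 0# < x → ∃[ y ] x * y ≈ 1#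
  0<⇒invertible {x} 0<x =
    let (y , _ , p) = #⇒invertible (#-sym (<⇒# 0<x))
    in y , trans (*-congʳ (sym (x-0≈x (HeytingField.heytingCommutativeRing heytingField) x))) p

  -- Being invertible, `y` is apart from 0 and so has a sign; a negative `y` would make
  -- `0# - x * y`, that is -1, positive.
  inverse-pos : ∀ {x y} → 0# < x → x * y ≈ 1# → 0# < y
  inverse-pos {x} {y} 0<x p with #⇒< (invertible⇒# (x , trans (*-congˡ (y-0 y)) p , trans (*-congʳ (y-0 y)) (trans (*-comm y x) p)))
    where
    y-0 : ∀ y → y - 0# ≈ y
    y-0 = x-0≈x (HeytingField.heytingCommutativeRing heytingField)
  ... | inj₂ 0<y = 0<y
  ... | inj₁ y<0 = ⊥-elim (<.irrefl ≈-refl (<.trans 0<1 (0<⇒< (*-pos 0<x (<⇒0<- y<0))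
    (trans (solve 2 (λ x y → x :* (con (+ 0) :- y) := con (+ 0) :- x :* y) ≈-refl x y) (+-congˡ (-‿cong p))))))

  0<1/ : ∀ n .{{_ : NonZero n}} → 0# < 1/ n
  0<1/ (suc n) = inverse-pos (0<fromℕ n) (1/-inverse (suc n))

  half : Carrier → Carrier
  half x = x * 1/ 2

  half+half : ∀ x → half x + half x ≈ x
  half+half x = begin
    x * 1/ 2 + x * 1/ 2        ≈⟨ solve 2 (λ x h → x :* h :+ x :* h := x :* (con (+ 2) :* h)) ≈-refl x (1/ 2) ⟩
    x * (fromℕ 2 * 1/ 2)       ≈⟨ *-congˡ (1/-inverse 2) ⟩
    x * 1#                     ≈⟨ *-identityʳ x ⟩
    x                          ∎

  half-pos : ∀ {x} → 0# < x → 0# < half x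
  half-pos 0<x = *-pos 0<x (0<1/ 2)

  0<x+x⇒0<x : ∀ {x} → 0# < x + x → 0# < x
  0<x+x⇒0<x {x} p = <-cong ≈-refl
    (trans (solve 2 (λ x h → (x :+ x) :* h := x :* h :+ x :* h) ≈-refl x (1/ 2)) (half+half x)) (half-pos p)

  -- The constructive substitute for trichotomy, inherited from the cotransitivity of apartness.
  <-cotrans : ∀ {x y} → x < y → ∀ z → x < z ⊎ z < y
  <-cotrans x<y z with #-cotrans (<⇒# x<y) z
  ... | inj₁ x#z with #⇒< x#z
  ...   | inj₁ x<z = inj₁ x<z
  ...   | inj₂ z<x = inj₂ (<.trans z<x x<y)
  <-cotrans x<y z | inj₂ z#y with #⇒< z#y
  ...   | inj₁ z<y = inj₂ z<y
  ...   | inj₂ y<z = inj₁ (<.trans x<y y<z)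

  infix 4 _≤_
  _≤_ : Carrier → Carrier → Set ℓ₃
  x ≤ y = ¬ (y < x)

  ≤-cong : ∀ {x x′ y y′} → x ≈ x′ → y ≈ y′ → x ≤ y → x′ ≤ y′
  ≤-cong p q x≤y y′<x′ = x≤y (<-cong (sym q) (sym p) y′<x′)

  ≤-refl : ∀ {x y} → x ≈ y → x ≤ y
  ≤-refl p y<x = <.irrefl (sym p) y<x

  <⇒≤ : ∀ {x y} → x < y → x ≤ y
  <⇒≤ x<y y<x = <.irrefl ≈-refl (<.trans x<y y<x)

  ≤-trans : ∀ {x y z} → x ≤ y → y ≤ z → x ≤ z
  ≤-trans {y = y} x≤y y≤z z<x with <-cotrans z<x y
  ... | inj₁ z<y = y≤z z<y
  ... | inj₂ y<x = x≤y y<x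

  ≤-<-trans : ∀ {x y z} → x ≤ y → y < z → x < z
  ≤-<-trans {x} x≤y y<z with <-cotrans y<z x
  ... | inj₁ y<x = ⊥-elim (x≤y y<x)
  ... | inj₂ x<z = x<z

  ≤⇒0≤- : ∀ {x y} → x ≤ y → 0# ≤ y - x
  ≤⇒0≤- {x} {y} x≤y p = x≤y (0<⇒< (<⇒0<- p) (solve 2 (λ x y → con (+ 0) :- (y :- x) := x :- y) ≈-refl x y))

  0≤⇒≤ : ∀ {x y d} → 0# ≤ d → d ≈ y - x → x ≤ y
  0≤⇒≤ {x} {y} 0≤d p y<x = 0≤d (0<⇒< (<⇒0<- y<x)
    (trans (solve 2 (λ x y → x :- y := con (+ 0) :- (y :- x)) ≈-refl x y) (+-congˡ (-‿cong (sym p)))))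

  +-nonneg : ∀ {x y} → 0# ≤ x → 0# ≤ y → 0# ≤ x + y
  +-nonneg {x} {y} 0≤x 0≤y = ≤-trans 0≤x (0≤⇒≤ 0≤y (solve 2 (λ x y → y := x :+ y :- x) ≈-refl x y))

  -- A negative product is invertible, hence so are both factors. Under the assumption to be refuted
  -- their signs can therefore be told apart.
  *-nonneg : ∀ {x y} → 0# ≤ x → 0# ≤ y → 0# ≤ x * y
  *-nonneg {x} {y} 0≤x 0≤y xy<0 with x#0 | y#0
    where
    inv = #⇒invertible (<⇒# xy<0)
    z = proj₁ inv
    xyz≈1 : x * y * z ≈ 1#
    xyz≈1 = trans (solve 3 (λ x y z → x :* y :* z := (x :* y :- con (+ 0)) :* z) ≈-refl x y z) (proj₂ (proj₂ inv))
    #0 : ∀ {a b} → a * b ≈ 1# → a # 0#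
    #0 {a} {b} p = invertible⇒# (b , trans (solve 2 (λ a b → b :* (a :- con (+ 0)) := a :* b) ≈-refl a b) p
                                   , trans (solve 2 (λ a b → (a :- con (+ 0)) :* b := a :* b) ≈-refl a b) p)
    x#0 = #⇒< (#0 (trans (sym (*-assoc x y z)) xyz≈1))
    y#0 = #⇒< (#0 (trans (solve 3 (λ x y z → y :* (x :* z) := x :* y :* z) ≈-refl x y z) xyz≈1))
  ... | inj₁ x<0 | _        = 0≤x x<0
  ... | inj₂ _   | inj₁ y<0 = 0≤y y<0
  ... | inj₂ 0<x | inj₂ 0<y = <⇒≤ (*-pos 0<x 0<y) xy<0

  +-mono-≤ : ∀ {x y u v} → x ≤ y → u ≤ v → x + u ≤ y + v
  +-mono-≤ {x} {y} {u} {v} p q = 0≤⇒≤ (+-nonneg (≤⇒0≤- p) (≤⇒0≤- q))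
    (solve 4 (λ x y u v → y :- x :+ (v :- u) := y :+ v :- (x :+ u)) ≈-refl x y u v)

  *-monoˡ-≤ : ∀ {x y z} → 0# ≤ z → x ≤ y → z * x ≤ z * y
  *-monoˡ-≤ {x} {y} {z} p q = 0≤⇒≤ (*-nonneg p (≤⇒0≤- q))
    (solve 3 (λ x y z → z :* (y :- x) := z :* y :- z :* x) ≈-refl x y z)

  0≤x+x⇒0≤x : ∀ {x} → 0# ≤ x + x → 0# ≤ x
  0≤x+x⇒0≤x p x<0 = p (<-cong ≈-refl (+-identityʳ 0#) (+-mono-< x<0 x<0))

  infix 4 ∣_∣<_ ∣_∣≤_
  ∣_∣<_ : Carrier → Carrier → Set ℓ₃
  ∣ x ∣< r = x < r × - x < r

  ∣_∣≤_ : Carrier → Carrier → Set ℓ₃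
  ∣ x ∣≤ r = x ≤ r × - x ≤ r

  ∣∣<-cong : ∀ {x y r s} → x ≈ y → r ≈ s → ∣ x ∣< r → ∣ y ∣< s
  ∣∣<-cong p q (u , v) = <-cong p q u , <-cong (-‿cong p) q v

  ∣∣≤-cong : ∀ {x y r s} → x ≈ y → r ≈ s → ∣ x ∣≤ r → ∣ y ∣≤ s
  ∣∣≤-cong p q (u , v) = ≤-cong p q u , ≤-cong (-‿cong p) q v

  ∣∣<-+ : ∀ {x y r s} → ∣ x ∣< r → ∣ y ∣< s → ∣ x + y ∣< (r + s)
  ∣∣<-+ {x} {y} (p , p′) (q , q′) = +-mono-< p q ,
    <-cong (solve 2 (λ x y → :- x :+ :- y := :- (x :+ y)) ≈-refl x y) ≈-refl (+-mono-< p′ q′)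

  ∣∣≤-+ : ∀ {x y r s} → ∣ x ∣≤ r → ∣ y ∣≤ s → ∣ x + y ∣≤ (r + s)
  ∣∣≤-+ {x} {y} (p , p′) (q , q′) = +-mono-≤ p q ,
    ≤-cong (solve 2 (λ x y → :- x :+ :- y := :- (x :+ y)) ≈-refl x y) ≈-refl (+-mono-≤ p′ q′)

  ∣∣<-neg : ∀ {x r} → ∣ x ∣< r → ∣ - x ∣< r
  ∣∣<-neg {x} (p , q) = q , <-cong (solve 1 (λ x → x := :- :- x) ≈-refl x) ≈-refl p

  ∣∣≤-neg : ∀ {x r} → ∣ x ∣≤ r → ∣ - x ∣≤ r
  ∣∣≤-neg {x} (p , q) = q , ≤-cong (solve 1 (λ x → x := :- :- x) ≈-refl x) ≈-refl p

  -- Uses (r - x)(s + y) + (r + x)(s - y) = 2 (r s - x y) and the same identity with -y for y. The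
  -- left sides are sums of positive products, so no case distinction on signs arises.
  ∣∣<-* : ∀ {x y r s} → ∣ x ∣< r → ∣ y ∣< s → ∣ x * y ∣< (r * s)
  ∣∣<-* {x} {y} {r} {s} (p , p′) (q , q′) =
    0<⇒< (0<x+x⇒0<x (<-cong ≈-refl
      (solve 4 (λ x y r s → (r :- x) :* (s :- :- y) :+ (r :- :- x) :* (s :- y) := (r :* s :- x :* y) :+ (r :* s :- x :* y)) ≈-refl x y r s)
      (+-pos (*-pos (<⇒0<- p) (<⇒0<- q′)) (*-pos (<⇒0<- p′) (<⇒0<- q))))) ≈-refl ,
    0<⇒< (0<x+x⇒0<x (<-cong ≈-refl
      (solve 4 (λ x y r s → (r :- x) :* (s :- y) :+ (r :- :- x) :* (s :- :- y) := (r :* s :- :- (x :* y)) :+ (r :* s :- :- (x :* y))) ≈-refl x y r s)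
      (+-pos (*-pos (<⇒0<- p) (<⇒0<- q)) (*-pos (<⇒0<- p′) (<⇒0<- q′))))) ≈-refl

  ∣∣≤-* : ∀ {x y r s} → ∣ x ∣≤ r → ∣ y ∣≤ s → ∣ x * y ∣≤ (r * s)
  ∣∣≤-* {x} {y} {r} {s} (p , p′) (q , q′) =
    0≤⇒≤ (0≤x+x⇒0≤x (≤-cong ≈-refl
      (solve 4 (λ x y r s → (r :- x) :* (s :- :- y) :+ (r :- :- x) :* (s :- y) := (r :* s :- x :* y) :+ (r :* s :- x :* y)) ≈-refl x y r s)
      (+-nonneg (*-nonneg (≤⇒0≤- p) (≤⇒0≤- q′)) (*-nonneg (≤⇒0≤- p′) (≤⇒0≤- q))))) ≈-refl ,
    0≤⇒≤ (0≤x+x⇒0≤x (≤-cong ≈-refl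
      (solve 4 (λ x y r s → (r :- x) :* (s :- y) :+ (r :- :- x) :* (s :- :- y) := (r :* s :- :- (x :* y)) :+ (r :* s :- :- (x :* y))) ≈-refl x y r s)
      (+-nonneg (*-nonneg (≤⇒0≤- p) (≤⇒0≤- q)) (*-nonneg (≤⇒0≤- p′) (≤⇒0≤- q′))))) ≈-refl

  ∣∣≤⇒0≤ : ∀ {x r} → ∣ x ∣≤ r → 0# ≤ r
  ∣∣≤⇒0≤ {x} (p , q) = 0≤x+x⇒0≤x (≤-cong (-‿inverseʳ x) ≈-refl (+-mono-≤ p q))

  fromℕ-nonneg : ∀ n → 0# ≤ fromℕ n
  fromℕ-nonneg zero    = ≤-refl ≈-refl
  fromℕ-nonneg (suc n) = <⇒≤ (0<fromℕ n)

  +-nonneg-pos : ∀ {x y} → 0# ≤ x → 0# < y → 0# < x + y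
  +-nonneg-pos {x} {y} 0≤x 0<y = ≤-<-trans 0≤x (0<⇒< 0<y (solve 2 (λ x y → y := x :+ y :- x) ≈-refl x y))

  bounded : ∀ x → ∃[ r ] 0# < r × ∣ x ∣< r
  bounded x =
    let (m , p) = archimedean x
        (n , q) = archimedean (- x)
    -- The sum replaces a maximum of the bounds for `x` and `- x`; the summand 1 makes it strictly
    -- positive.
    in fromℕ m + fromℕ n + 1# ,
       +-nonneg-pos (+-nonneg (fromℕ-nonneg m) (fromℕ-nonneg n)) 0<1 ,
       0<⇒< (+-nonneg-pos (fromℕ-nonneg n) (+-pos 0<1 (<⇒0<- p)))
         (solve 4 (λ x m n o → n :+ (o :+ (m :- x)) := m :+ n :+ o :- x) ≈-refl x (fromℕ m) (fromℕ n) 1#) ,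
       0<⇒< (+-nonneg-pos (fromℕ-nonneg m) (+-pos 0<1 (<⇒0<- q)))
         (solve 4 (λ x m n o → m :+ (o :+ (n :- x)) := m :+ n :+ o :- x) ≈-refl (- x) (fromℕ m) (fromℕ n) 1#)

  Null : (ℕ → Carrier) → Set (c ⊔ ℓ₃)
  Null s = ∀ ε → 0# < ε → ∃[ N ] (∀ n → N ℕ.≤ n → ∣ s n ∣< ε)

  Bounded : (ℕ → Carrier) → Set (c ⊔ ℓ₃)
  Bounded s = ∃[ r ] 0# < r × (∃[ N ] (∀ n → N ℕ.≤ n → ∣ s n ∣< r))

  null-cong : ∀ {s t} → (∀ n → s n ≈ t n) → Null s → Null t
  null-cong p null ε 0<ε =
    let (N , q) = null ε 0<ε in N , λ n N≤n → ∣∣<-cong (p n) ≈-refl (q n N≤n)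

  null-+ : ∀ {s t} → Null s → Null t → Null (λ n → s n + t n)
  null-+ null-s null-t ε 0<ε =
    let (M , p) = null-s (half ε) (half-pos 0<ε)
        (N , q) = null-t (half ε) (half-pos 0<ε)
    in M ℕ.+ N , λ n M+N≤n → ∣∣<-cong ≈-refl (half+half ε)
         (∣∣<-+ (p n (ℕ.m+n≤o⇒m≤o M M+N≤n)) (q n (ℕ.m+n≤o⇒n≤o M M+N≤n)))

  null-neg : ∀ {s} → Null s → Null (λ n → - s n)
  null-neg null ε 0<ε = let (N , p) = null ε 0<ε in N , λ n N≤n → ∣∣<-neg (p n N≤n)

  null-* : ∀ {s t} → Null s → Bounded t → Null (λ n → s n * t n)
  null-* {s} {t} null (r , 0<r , M , q) ε 0<ε =
    let (r⁻¹ , p) = 0<⇒invertible 0<r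
        (N , v) = null (ε * r⁻¹) (*-pos 0<ε (inverse-pos 0<r p))
    in M ℕ.+ N , λ n M+N≤n → ∣∣<-cong ≈-refl
         (trans (*-assoc ε r⁻¹ r) (trans (*-congˡ (trans (*-comm r⁻¹ r) p)) (*-identityʳ ε)))
         (∣∣<-* (v n (ℕ.m+n≤o⇒n≤o M M+N≤n)) (q n (ℕ.m+n≤o⇒m≤o M M+N≤n)))

  null-squeeze : ∀ {s t} → (∀ n → ∣ s n ∣≤ t n) → Null t → Null s
  null-squeeze p null ε 0<ε = let (N , q) = null ε 0<ε in
    N , λ n N≤n → ≤-<-trans (proj₁ (p n)) (proj₁ (q n N≤n)) , ≤-<-trans (proj₂ (p n)) (proj₁ (q n N≤n))

  null-double : ∀ {s} → Null s → Null (λ n → s (n ℕ.+ n))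
  null-double null ε 0<ε = let (N , q) = null ε 0<ε in
    N , λ n N≤n → q (n ℕ.+ n) (ℕ.≤-trans N≤n (ℕ.m≤m+n n n))

  -- By tightness it suffices to refute that `x` is apart from 0. If it were, `x` or `- x` would be
  -- a positive ε that the constant sequence never gets below.
  null-const : ∀ {x} → Null (λ _ → x) → x ≈ 0#
  null-const {x} null = proj₁ (tight x 0#) x¬#0
    where
    x¬#0 : ¬ x # 0#
    x¬#0 x#0 with #⇒< x#0
    ... | inj₁ x<0 = let (N , q) = null (- x) (0<⇒< (<⇒0<- x<0) (solve 1 (λ x → con (+ 0) :- x := :- x :- con (+ 0)) ≈-refl x))
                     in <.irrefl ≈-refl (proj₂ (q N ℕ.≤-refl))
    ... | inj₂ 0<x = let (N , q) = null x 0<x in <.irrefl ≈-refl (proj₁ (q N ℕ.≤-refl))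

  ⟶⇒null : ∀ {s x} → s ⟶ x → Null (λ n → s n - x)
  ⟶⇒null {s} {x} lim ε 0<ε = let (N , p) = lim ε 0<ε in N , λ n N≤n →
    proj₁ (p n N≤n) , <-cong (solve 2 (λ s x → x :- s := :- (s :- x)) ≈-refl (s n) x) ≈-refl (proj₂ (p n N≤n))

  null⇒⟶ : ∀ {s x} → Null (λ n → s n - x) → s ⟶ x
  null⇒⟶ {s} {x} null ε 0<ε = let (N , p) = null ε 0<ε in N , λ n N≤n →
    proj₁ (p n N≤n) , <-cong (solve 2 (λ s x → :- (s :- x) := x :- s) ≈-refl (s n) x) ≈-refl (proj₂ (p n N≤n))

  ⟶-cong : ∀ {s t x y} → (∀ n → s n ≈ t n) → x ≈ y → s ⟶ x → t ⟶ y
  ⟶-cong p q lim = null⇒⟶ (null-cong (λ n → +-cong (p n) (-‿cong q)) (⟶⇒null lim))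

  ⟶-+ : ∀ {s t x y} → s ⟶ x → t ⟶ y → (λ n → s n + t n) ⟶ (x + y)
  ⟶-+ {s} {t} {x} {y} p q = null⇒⟶ (null-cong
    (λ n → solve 4 (λ s t x y → s :- x :+ (t :- y) := s :+ t :- (x :+ y)) ≈-refl (s n) (t n) x y)
    (null-+ (⟶⇒null p) (⟶⇒null q)))

  ⟶-neg : ∀ {s x} → s ⟶ x → (λ n → - s n) ⟶ (- x)
  ⟶-neg {s} {x} p = null⇒⟶ (null-cong
    (λ n → solve 2 (λ s x → :- (s :- x) := :- s :- :- x) ≈-refl (s n) x) (null-neg (⟶⇒null p)))

  ⟶⇒bounded : ∀ {s x} → s ⟶ x → Bounded s
  ⟶⇒bounded {s} {x} lim =
    let (r , 0<r , p) = bounded x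
        (N , q) = ⟶⇒null lim 1# 0<1
    in 1# + r , +-pos 0<1 0<r , N , λ n N≤n → ∣∣<-cong
         (solve 2 (λ s x → s :- x :+ x := s) ≈-refl (s n) x) ≈-refl (∣∣<-+ (q n N≤n) p)

  ⟶-* : ∀ {s t x y} → s ⟶ x → t ⟶ y → (λ n → s n * t n) ⟶ (x * y)
  ⟶-* {s} {t} {x} {y} p q = null⇒⟶ (null-cong
    (λ n → solve 4 (λ s t x y → (s :- x) :* t :+ (t :- y) :* x := s :* t :- x :* y) ≈-refl (s n) (t n) x y)
    (null-+ (null-* (⟶⇒null p) (⟶⇒bounded q))
            (null-* (⟶⇒null q) (let (r , 0<r , b) = bounded x in r , 0<r , 0 , λ _ _ → b))))

  ⟶-unique : ∀ {s t x y} → s ⟶ x → t ⟶ y → Null (λ n → s n - t n) → x ≈ y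
  ⟶-unique {s} {t} {x} {y} p q null = begin
    x                ≈⟨ solve 2 (λ x y → x := x :- y :+ y) ≈-refl x y ⟩
    x - y + y        ≈⟨ +-congʳ (null-const (null-cong
                          (λ n → solve 4 (λ s t x y → s :- t :+ (:- (s :- x) :+ (t :- y)) := x :- y) ≈-refl (s n) (t n) x y)
                          (null-+ null (null-+ (null-neg (⟶⇒null p)) (⟶⇒null q))))) ⟩
    0# + y           ≈⟨ +-identityˡ y ⟩
    y                ∎

  null-0 : Null (λ _ → 0#)
  null-0 ε 0<ε = 0 , λ _ _ → 0<ε , <-cong (solve 0 (con (+ 0) := :- con (+ 0)) ≈-refl) ≈-refl 0<ε

-- The exponential series

module PowerSeries {c ℓ} (R : CommutativeRing c ℓ) where
  open CommutativeRing R renaming (refl to ≈-refl; zero to *-zero)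
  open Integers R
  open Solver using (solve; _:=_; _:+_; _:*_; :-_; _:-_; con)
  open import Relation.Binary.Reasoning.Setoid setoid

  Σ< : (ℕ → Carrier) → ℕ → Carrier
  Σ< a zero    = 0#
  Σ< a (suc n) = Σ< a n + a n

  Σ<-cong : ∀ {a b} → (∀ n → a n ≈ b n) → ∀ n → Σ< a n ≈ Σ< b n
  Σ<-cong p zero    = ≈-refl
  Σ<-cong p (suc n) = +-cong (Σ<-cong p n) (p n)

  Σ<-first : ∀ a n → Σ< a (suc n) ≈ a 0 + Σ< (a ∘ suc) n
  Σ<-first a zero    = +-comm 0# (a 0)
  Σ<-first a (suc n) = trans (+-congʳ (Σ<-first a n)) (+-assoc _ _ _)

  Σ<-+ : ∀ a b n → Σ< (λ k → a k + b k) n ≈ Σ< a n + Σ< b n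
  Σ<-+ a b zero    = sym (+-identityʳ 0#)
  Σ<-+ a b (suc n) = trans (+-congʳ (Σ<-+ a b n))
    (solve 4 (λ x y u v → x :+ y :+ (u :+ v) := x :+ u :+ (y :+ v)) ≈-refl _ _ _ _)

  Σ<-* : ∀ x a n → Σ< (λ k → x * a k) n ≈ x * Σ< a n
  Σ<-* x a zero    = sym (zeroʳ x)
  Σ<-* x a (suc n) = trans (+-congʳ (Σ<-* x a n)) (sym (distribˡ x _ _))

  -- The n-th coefficient of the Cauchy product, a₀bₙ + a₁bₙ₋₁ + … + aₙb₀.
  conv : (ℕ → Carrier) → (ℕ → Carrier) → ℕ → Carrier
  conv a b zero    = a 0 * b 0
  conv a b (suc n) = a 0 * b (suc n) + conv (a ∘ suc) b n

  conv-cong : ∀ {a a′ b b′} → (∀ n → a n ≈ a′ n) → (∀ n → b n ≈ b′ n) → ∀ n → conv a b n ≈ conv a′ b′ n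
  conv-cong p q zero    = *-cong (p 0) (q 0)
  conv-cong p q (suc n) = +-cong (*-cong (p 0) (q (suc n))) (conv-cong (p ∘ suc) q n)

  conv-+ˡ : ∀ a a′ b n → conv (λ k → a k + a′ k) b n ≈ conv a b n + conv a′ b n
  conv-+ˡ a a′ b zero    = distribʳ _ _ _
  conv-+ˡ a a′ b (suc n) = trans (+-congˡ (conv-+ˡ (a ∘ suc) (a′ ∘ suc) b n))
    (solve 5 (λ x y z u v → (x :+ y) :* z :+ (u :+ v) := x :* z :+ u :+ (y :* z :+ v)) ≈-refl _ _ _ _ _)

  conv-*ˡ : ∀ x a b n → conv (λ k → x * a k) b n ≈ x * conv a b n
  conv-*ˡ x a b zero    = *-assoc _ _ _
  conv-*ˡ x a b (suc n) = trans (+-congˡ (conv-*ˡ x (a ∘ suc) b n))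
    (solve 4 (λ x y z u → x :* y :* z :+ x :* u := x :* (y :* z :+ u)) ≈-refl _ _ _ _)

  conv-*ʳ : ∀ x a b n → conv a (λ k → x * b k) n ≈ x * conv a b n
  conv-*ʳ x a b zero    = solve 3 (λ x y z → y :* (x :* z) := x :* (y :* z)) ≈-refl _ _ _
  conv-*ʳ x a b (suc n) = trans (+-congˡ (conv-*ʳ x (a ∘ suc) b n))
    (solve 4 (λ x y z u → y :* (x :* z) :+ x :* u := x :* (y :* z :+ u)) ≈-refl _ _ _ _)

  -- Splits off the first coefficient of the left factor. Inductions on partial sums of products
  -- shift `a` and leave `b` alone.
  Σ<-conv-suc : ∀ a b n → Σ< (conv a b) (suc n) ≈ a 0 * Σ< b (suc n) + Σ< (conv (a ∘ suc) b) n
  Σ<-conv-suc a b n = begin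
    Σ< (conv a b) (suc n)
      ≈⟨ Σ<-first (conv a b) n ⟩
    a 0 * b 0 + Σ< (λ k → a 0 * b (suc k) + conv (a ∘ suc) b k) n
      ≈⟨ +-congˡ (trans (Σ<-+ _ _ n) (+-congʳ (Σ<-* (a 0) (b ∘ suc) n))) ⟩
    a 0 * b 0 + (a 0 * Σ< (b ∘ suc) n + Σ< (conv (a ∘ suc) b) n)
      ≈⟨ solve 4 (λ x y z w → x :* y :+ (x :* z :+ w) := x :* (y :+ z) :+ w) ≈-refl _ _ _ _ ⟩
    a 0 * (b 0 + Σ< (b ∘ suc) n) + Σ< (conv (a ∘ suc) b) n
      ≈⟨ +-congʳ (*-congˡ (Σ<-first b n)) ⟨
    a 0 * Σ< b (suc n) + Σ< (conv (a ∘ suc) b) n ∎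

  derivative : (ℕ → Carrier) → ℕ → Carrier
  derivative a n = ⟦ + suc n ⟧ * a (suc n)

  -- The Leibniz rule for formal power series.
  derivative-conv : ∀ a b n →
    derivative (conv a b) n ≈ conv (derivative a) b n + conv a (derivative b) n
  derivative-conv a b zero =
    solve 4 (λ x y u v → con (+ 1) :* (x :* v :+ y :* u) := con (+ 1) :* y :* u :+ x :* (con (+ 1) :* v)) ≈-refl (a 0) (a 1) (b 0) (b 1)
  derivative-conv a b (suc n) = begin
    (1# + N) * (a 0 * b (suc (suc n)) + (a 1 * b (suc n) + conv a″ b n))
      -- One copy of the shifted product is set aside. The other `N` copies are its derivative, and
      -- the single copy later turns the coefficients of `derivative a′` into those of the shifted
      -- `derivative a`.
      ≈⟨ solve 4 (λ o N x y → (o :+ N) :* (x :+ y) := (o :+ N) :* x :+ (o :* y :+ N :* y)) ≈-refl 1# N _ _ ⟩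
    (1# + N) * (a 0 * b (suc (suc n))) + (1# * (a 1 * b (suc n) + conv a″ b n) + N * conv a′ b (suc n))
      ≈⟨ +-congˡ (+-cong (*-identityˡ _) (derivative-conv a′ b n)) ⟩
    (1# + N) * (a 0 * b (suc (suc n))) +
      (a 1 * b (suc n) + conv a″ b n + (conv (derivative a′) b n + conv a′ (derivative b) n))
      ≈⟨ solve 8 (λ s x y z w u v e →
           s :* (x :* w) :+ (y :* z :+ u :+ (v :+ e)) := con (+ 1) :* y :* z :+ (u :+ v) :+ (x :* (s :* w) :+ e))
           ≈-refl (1# + N) (a 0) (a 1) (b (suc n)) (b (suc (suc n))) (conv a″ b n) (conv (derivative a′) b n) (conv a′ (derivative b) n) ⟩
    derivative a 0 * b (suc n) + (conv a″ b n + conv (derivative a′) b n) + (a 0 * derivative b (suc n) + conv a′ (derivative b) n)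
      ≈⟨ +-congʳ (+-congˡ (trans
           (conv-cong (λ k → trans (distribʳ _ _ _) (+-congʳ (*-identityˡ _))) (λ _ → ≈-refl) n)
           (conv-+ˡ a″ (derivative a′) b n))) ⟨
    conv (derivative a) b (suc n) + conv a (derivative b) (suc n) ∎
    where
    N  = ⟦ + suc n ⟧
    a′ = a ∘ suc
    a″ = a′ ∘ suc

  -- aₙ = zⁿ/n!
  IsExponential : Carrier → (ℕ → Carrier) → Set ℓ
  IsExponential z a = a 0 ≈ 1# × (∀ n → derivative a n ≈ z * a n)

  exponential-cong : ∀ {z w a} → z ≈ w → IsExponential z a → IsExponential w a
  exponential-cong p (q , r) = q , λ n → trans (r n) (*-congʳ p)

  -- The addition theorem for formal series: the Leibniz rule gives the recurrence for `z + w`, in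
  -- place of the binomial theorem.
  exponential-conv : ∀ {z w a b} → IsExponential z a → IsExponential w b → IsExponential (z + w) (conv a b)
  exponential-conv {z} {w} {a} {b} (p , p′) (q , q′) = trans (*-cong p q) (*-identityˡ 1#) , λ n → begin
    derivative (conv a b) n                                ≈⟨ derivative-conv a b n ⟩
    conv (derivative a) b n + conv a (derivative b) n      ≈⟨ +-cong (conv-cong p′ (λ _ → ≈-refl) n) (conv-cong {a} (λ _ → ≈-refl) q′ n) ⟩
    conv (λ k → z * a k) b n + conv a (λ k → w * b k) n    ≈⟨ +-cong (conv-*ˡ z a b n) (conv-*ʳ w a b n) ⟩
    z * conv a b n + w * conv a b n                        ≈⟨ distribʳ _ z w ⟨
    (z + w) * conv a b n                                   ∎

  module _ (cancel : ∀ n {x y} → ⟦ + suc n ⟧ * x ≈ ⟦ + suc n ⟧ * y → x ≈ y) where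
    exponential-unique : ∀ {z a b} → IsExponential z a → IsExponential z b → ∀ n → a n ≈ b n
    exponential-unique (p , p′) (q , q′) zero    = trans p (sym q)
    exponential-unique (p , p′) (q , q′) (suc n) = cancel n
      (trans (p′ n) (trans (*-congˡ (exponential-unique (p , p′) (q , q′) n)) (sym (q′ n))))

  -- For `n` at most `m` this is the sum of aᵢ bⱼ over i < n, j < m, i + j ≥ n. Two lengths are kept
  -- because the recursion shortens only the first factor.
  Δ : (ℕ → Carrier) → (ℕ → Carrier) → ℕ → ℕ → Carrier
  Δ a b n m = Σ< a n * Σ< b m - Σ< (conv a b) n

  Δ-suc : ∀ a b n m → Δ a b (suc n) m ≈ a 0 * (Σ< b m - Σ< b (suc n)) + Δ (a ∘ suc) b n m
  Δ-suc a b n m = begin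
    Σ< a (suc n) * Σ< b m - Σ< (conv a b) (suc n)
      ≈⟨ +-cong (*-congʳ (Σ<-first a n)) (-‿cong (Σ<-conv-suc a b n)) ⟩
    (a 0 + Σ< (a ∘ suc) n) * Σ< b m - (a 0 * Σ< b (suc n) + Σ< (conv (a ∘ suc) b) n)
      ≈⟨ solve 5 (λ x s t u v → (x :+ s) :* t :- (x :* u :+ v) := x :* (t :- u) :+ (s :* t :- v)) ≈-refl _ _ _ _ _ ⟩
    a 0 * (Σ< b m - Σ< b (suc n)) + Δ (a ∘ suc) b n m ∎

-- The commutative ring of complex numbers

module ComplexNumbers {c ℓ₁ ℓ₂ ℓ₃} (ℝ : RealNumbers c ℓ₁ ℓ₂ ℓ₃) where
  open RealNumbers ℝ hiding (zero) renaming (refl to ≈-refl)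
  open Integers commutativeRing
  open Solver using (solve; _:=_; _:+_; _:*_; :-_; _:-_; con)
  open Complex ℝ

  infix 4 _≈ᶜ_
  record _≈ᶜ_ (z w : ℂ) : Set ℓ₁ where
    constructor _,ᶜ_
    field
      re-≈ : re z ≈ re w
      im-≈ : im z ≈ im w
  open _≈ᶜ_ public

  infix 8 -ᶜ_
  -ᶜ_ : ℂ → ℂ
  -ᶜ z = (- re z) +i (- im z)

  conjugate : ℂ → ℂ
  conjugate z = re z +i (- im z)

  ℂ-commutativeRing : CommutativeRing c ℓ₁
  ℂ-commutativeRing = record
    { Carrier = ℂ
    ; _≈_ = _≈ᶜ_
    ; _+_ = _+ᶜ_
    ; _*_ = _*ᶜ_
    ; -_  = -ᶜ_
    ; 0#  = 0ᶜ
    ; 1#  = 1ᶜ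
    ; isCommutativeRing = record
      { isRing = record
        { +-isAbelianGroup = record
          { isGroup = record
            { isMonoid = record
              { isSemigroup = record
                { isMagma = record
                  { isEquivalence = record
                    { refl  = ≈-refl ,ᶜ ≈-refl
                    ; sym   = λ (p ,ᶜ q) → sym p ,ᶜ sym q
                    ; trans = λ (p ,ᶜ q) (p′ ,ᶜ q′) → trans p p′ ,ᶜ trans q q′
                    }
                  ; ∙-cong = λ (p ,ᶜ q) (p′ ,ᶜ q′) → +-cong p p′ ,ᶜ +-cong q q′
                  }
                ; assoc = λ _ _ _ → +-assoc _ _ _ ,ᶜ +-assoc _ _ _
                }
              ; identity = (λ _ → +-identityˡ _ ,ᶜ +-identityˡ _) , (λ _ → +-identityʳ _ ,ᶜ +-identityʳ _)
              }
            ; inverse = (λ _ → -‿inverseˡ _ ,ᶜ -‿inverseˡ _) , (λ _ → -‿inverseʳ _ ,ᶜ -‿inverseʳ _)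
            ; ⁻¹-cong = λ (p ,ᶜ q) → -‿cong p ,ᶜ -‿cong q
            }
          ; comm = λ _ _ → +-comm _ _ ,ᶜ +-comm _ _
          }
        ; *-cong = λ (p ,ᶜ q) (p′ ,ᶜ q′) →
            +-cong (*-cong p p′) (-‿cong (*-cong q q′)) ,ᶜ +-cong (*-cong p q′) (*-cong q p′)
        ; *-assoc = λ z w v →
            solve 6 (λ a b c d e f → (a :* c :- b :* d) :* e :- (a :* d :+ b :* c) :* f := a :* (c :* e :- d :* f) :- b :* (c :* f :+ d :* e))
              ≈-refl (re z) (im z) (re w) (im w) (re v) (im v) ,ᶜ
            solve 6 (λ a b c d e f → (a :* c :- b :* d) :* f :+ (a :* d :+ b :* c) :* e := a :* (c :* f :+ d :* e) :+ b :* (c :* e :- d :* f))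
              ≈-refl (re z) (im z) (re w) (im w) (re v) (im v)
        ; *-identity =
            (λ z → 1*-re z ,ᶜ 1*-im z) ,
            (λ z → trans (*-comm-re z 1ᶜ) (1*-re z) ,ᶜ trans (*-comm-im z 1ᶜ) (1*-im z))
        ; distrib =
            (λ z w v →
              solve 6 (λ a b c d e f → a :* (c :+ e) :- b :* (d :+ f) := (a :* c :- b :* d) :+ (a :* e :- b :* f))
                ≈-refl (re z) (im z) (re w) (im w) (re v) (im v) ,ᶜ
              solve 6 (λ a b c d e f → a :* (d :+ f) :+ b :* (c :+ e) := (a :* d :+ b :* c) :+ (a :* f :+ b :* e))
                ≈-refl (re z) (im z) (re w) (im w) (re v) (im v)) ,
            (λ z w v →
              solve 6 (λ a b c d e f → (c :+ e) :* a :- (d :+ f) :* b := (c :* a :- d :* b) :+ (e :* a :- f :* b))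
                ≈-refl (re z) (im z) (re w) (im w) (re v) (im v) ,ᶜ
              solve 6 (λ a b c d e f → (c :+ e) :* b :+ (d :+ f) :* a := (c :* b :+ d :* a) :+ (e :* b :+ f :* a))
                ≈-refl (re z) (im z) (re w) (im w) (re v) (im v))
        }
      ; *-comm = λ z w → *-comm-re z w ,ᶜ *-comm-im z w
      }
    }
    where
    *-comm-re : ∀ z w → re (z *ᶜ w) ≈ re (w *ᶜ z)
    *-comm-re z w = solve 4 (λ a b c d → a :* c :- b :* d := c :* a :- d :* b) ≈-refl (re z) (im z) (re w) (im w)
    *-comm-im : ∀ z w → im (z *ᶜ w) ≈ im (w *ᶜ z)
    *-comm-im z w = solve 4 (λ a b c d → a :* d :+ b :* c := c :* b :+ d :* a) ≈-refl (re z) (im z) (re w) (im w)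
    1*-re : ∀ z → re (1ᶜ *ᶜ z) ≈ re z
    1*-re z = trans (+-congʳ (*-identityˡ (re z))) (solve 2 (λ a b → a :- con (+ 0) :* b := a) ≈-refl (re z) (im z))
    1*-im : ∀ z → im (1ᶜ *ᶜ z) ≈ im z
    1*-im z = trans (+-congʳ (*-identityˡ (im z))) (solve 2 (λ a b → b :+ con (+ 0) :* a := b) ≈-refl (re z) (im z))

-- The complex exponential function and its addition theorem

module ComplexExponential {c ℓ₁ ℓ₂ ℓ₃} (ℝ : RealNumbers c ℓ₁ ℓ₂ ℓ₃) where
  open RealNumbers ℝ hiding (zero) renaming (refl to ≈-refl)
  open Integers commutativeRing
  open Solver using (solve; _:=_; _:+_; _:*_; :-_; _:-_; con)
  open Complex ℝ
  open ComplexNumbers ℝ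
  open Limits ℝ
  open PowerSeries commutativeRing
  private
    module ℂR = CommutativeRing ℂ-commutativeRing
    module ℂ-series = PowerSeries ℂ-commutativeRing
    module ℂ-integers = Integers ℂ-commutativeRing
  open import Algebra.Properties.Semiring.Mult (CommutativeRing.semiring commutativeRing) using (×1-homo-*)

  ℂ-fromℕ : ∀ n → ℂ-integers.⟦ + n ⟧ ≈ᶜ (fromℕ n +i 0#)
  ℂ-fromℕ zero    = ℂR.refl
  ℂ-fromℕ (suc n) = +-congˡ (re-≈ (ℂ-fromℕ n)) ,ᶜ trans (+-identityˡ _) (im-≈ (ℂ-fromℕ n))

  real-* : ∀ r z → (r +i 0#) *ᶜ z ≈ᶜ r ∙ᶜ z
  real-* r z = solve 3 (λ r a b → r :* a :- con (+ 0) :* b := r :* a) ≈-refl r (re z) (im z)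
            ,ᶜ solve 3 (λ r a b → r :* b :+ con (+ 0) :* a := r :* b) ≈-refl r (re z) (im z)

  ℂ-fromℕ-* : ∀ n z → ℂ-integers.⟦ + n ⟧ *ᶜ z ≈ᶜ fromℕ n ∙ᶜ z
  ℂ-fromℕ-* n z = ℂR.trans (ℂR.*-congʳ (ℂ-fromℕ n)) (real-* (fromℕ n) z)

  1/-cancel : ∀ n x → 1/ (suc n) * (fromℕ (suc n) * x) ≈ x
  1/-cancel n x = trans (solve 3 (λ u k x → u :* (k :* x) := k :* u :* x) ≈-refl (1/ (suc n)) (fromℕ (suc n)) x)
    (trans (*-congʳ (1/-inverse (suc n))) (*-identityˡ x))

  fromℕ-cancel : ∀ n {x y} → fromℕ (suc n) * x ≈ fromℕ (suc n) * y → x ≈ y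
  fromℕ-cancel n {x} {y} p = trans (sym (1/-cancel n x)) (trans (*-congˡ p) (1/-cancel n y))

  ℂ-fromℕ-cancel : ∀ n {z w} → ℂ-integers.⟦ + suc n ⟧ *ᶜ z ≈ᶜ ℂ-integers.⟦ + suc n ⟧ *ᶜ w → z ≈ᶜ w
  ℂ-fromℕ-cancel n {z} {w} p = fromℕ-cancel n (re-≈ q) ,ᶜ fromℕ-cancel n (im-≈ q)
    where
    q : fromℕ (suc n) ∙ᶜ z ≈ᶜ fromℕ (suc n) ∙ᶜ w
    q = ℂR.trans (ℂR.sym (ℂ-fromℕ-* (suc n) z)) (ℂR.trans p (ℂ-fromℕ-* (suc n) w))

  1/! : ℕ → Carrier
  1/! n = 1/ (n !) {{n ℕ.!≢0}}

  -- Inverses are handled only through `1/-inverse`, so the recursion of the inverse factorials is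
  -- derived by inserting n! times its inverse.
  1/!-suc : ∀ n → fromℕ (suc n) * 1/! (suc n) ≈ 1/! n
  1/!-suc n = begin
    k * 1/! (suc n)                        ≈⟨ *-identityʳ _ ⟨
    k * 1/! (suc n) * 1#                   ≈⟨ *-congˡ (1/-inverse (n !) {{n ℕ.!≢0}}) ⟨
    k * 1/! (suc n) * (fromℕ (n !) * 1/! n) ≈⟨ solve 4 (λ k v x u → k :* v :* (x :* u) := k :* x :* v :* u) ≈-refl k (1/! (suc n)) (fromℕ (n !)) (1/! n) ⟩
    k * fromℕ (n !) * 1/! (suc n) * 1/! n  ≈⟨ *-congʳ (*-congʳ (×1-homo-* (suc n) (n !))) ⟨
    fromℕ (suc n !) * 1/! (suc n) * 1/! n  ≈⟨ *-congʳ (1/-inverse (suc n !) {{suc n ℕ.!≢0}}) ⟩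
    1# * 1/! n                             ≈⟨ *-identityˡ _ ⟩
    1/! n                                  ∎
    where
    open import Relation.Binary.Reasoning.Setoid setoid
    k = fromℕ (suc n)

  term : ℂ → ℕ → ℂ
  term z n = 1/! n ∙ᶜ z ^ᶜ n

  term-exponential : ∀ z → ℂ-series.IsExponential z (term z)
  term-exponential z =
    (trans (*-identityʳ _) (trans (sym (*-identityˡ _)) (trans (*-congʳ (sym ⟦⟧-1)) (1/-inverse 1))) ,ᶜ CommutativeRing.zeroʳ commutativeRing _) ,
    λ n → ℂR.trans (ℂ-fromℕ-* (suc n) (term z (suc n)))
      ((trans (sym (*-assoc _ _ _)) (trans (*-congʳ (1/!-suc n))
         (solve 5 (λ u a b c d → u :* (a :* c :- b :* d) := a :* (u :* c) :- b :* (u :* d)) ≈-refl (1/! n) (re z) (im z) (re (z ^ᶜ n)) (im (z ^ᶜ n))))) ,ᶜ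
       (trans (sym (*-assoc _ _ _)) (trans (*-congʳ (1/!-suc n))
         (solve 5 (λ u a b c d → u :* (a :* d :+ b :* c) := a :* (u :* d) :+ b :* (u :* c)) ≈-refl (1/! n) (re z) (im z) (re (z ^ᶜ n)) (im (z ^ᶜ n))))))

  exponential-term : ∀ {z a} → ℂ-series.IsExponential z a → ∀ n → a n ≈ᶜ term z n
  exponential-term p = ℂ-series.exponential-unique ℂ-fromℕ-cancel p (term-exponential _)

  expPartialSum-≡ : ∀ z n → expPartialSum z n ≡ ℂ-series.Σ< (term z) n
  expPartialSum-≡ z zero    = refl
  expPartialSum-≡ z (suc n) = cong (_+ᶜ term z n) (expPartialSum-≡ z n)

  -- The real series is taken from the complex one, because `IsExp` at `t +i 0#` is the source of
  -- its convergence.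
  realTerm : Carrier → ℕ → Carrier
  realTerm t n = re (term (t +i 0#) n)

  realTerm-exponential : ∀ t → IsExponential t (realTerm t)
  realTerm-exponential t =
    let (p , q) = term-exponential (t +i 0#) in
    re-≈ p , λ n → trans (sym (re-≈ (ℂ-fromℕ-* (suc n) (term (t +i 0#) (suc n)))))
      (trans (re-≈ (q n)) (solve 3 (λ t x y → t :* x :- con (+ 0) :* y := t :* x) ≈-refl t (realTerm t n) (im (term (t +i 0#) n))))

  re-Σ< : ∀ a n → re (ℂ-series.Σ< a n) ≡ Σ< (re ∘ a) n
  re-Σ< a zero    = refl
  re-Σ< a (suc n) = cong (_+ re (a n)) (re-Σ< a n)

  -- A bound of the 1-norm, chosen because that norm is submultiplicative; absolute values
  -- are avoided since the order is not decidable.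
  infix 4 _⊑_
  _⊑_ : ℂ → Carrier → Set (c ⊔ ℓ₁ ⊔ ℓ₃)
  z ⊑ r = ∃[ p ] ∃[ q ] ∣ re z ∣≤ p × ∣ im z ∣≤ q × p + q ≈ r

  ⊑-cong : ∀ {z w r s} → z ≈ᶜ w → r ≈ s → z ⊑ r → w ⊑ s
  ⊑-cong (u ,ᶜ v) e (p , q , x , y , d) = p , q , ∣∣≤-cong u ≈-refl x , ∣∣≤-cong v ≈-refl y , trans d e

  ⊑-+ : ∀ {z w r s} → z ⊑ r → w ⊑ s → z +ᶜ w ⊑ r + s
  ⊑-+ (p , q , x , y , d) (p′ , q′ , x′ , y′ , d′) = p + p′ , q + q′ , ∣∣≤-+ x x′ , ∣∣≤-+ y y′ ,
    trans (solve 4 (λ p q p′ q′ → p :+ p′ :+ (q :+ q′) := p :+ q :+ (p′ :+ q′)) ≈-refl p q p′ q′) (+-cong d d′)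

  ⊑-* : ∀ {z w r s} → z ⊑ r → w ⊑ s → z *ᶜ w ⊑ r * s
  ⊑-* (p , q , x , y , d) (p′ , q′ , x′ , y′ , d′) = p * p′ + q * q′ , p * q′ + q * p′ ,
    ∣∣≤-+ (∣∣≤-* x x′) (∣∣≤-neg (∣∣≤-* y y′)) , ∣∣≤-+ (∣∣≤-* x y′) (∣∣≤-* y x′) ,
    trans (solve 4 (λ p q p′ q′ → p :* p′ :+ q :* q′ :+ (p :* q′ :+ q :* p′) := (p :+ q) :* (p′ :+ q′)) ≈-refl p q p′ q′) (*-cong d d′)

  ∣0∣≤0 : ∣ 0# ∣≤ 0#
  ∣0∣≤0 = ≤-refl ≈-refl , ≤-refl (solve 0 (:- con (+ 0) := con (+ 0)) ≈-refl)

  nonneg⇒∣∣≤ : ∀ {r} → 0# ≤ r → ∣ r ∣≤ r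
  nonneg⇒∣∣≤ {r} 0≤r = ≤-refl ≈-refl , 0≤⇒≤ (+-nonneg 0≤r 0≤r) (solve 1 (λ r → r :+ r := r :- :- r) ≈-refl r)

  real-⊑ : ∀ {r} → 0# ≤ r → (r +i 0#) ⊑ r
  real-⊑ {r} 0≤r = r , 0# , nonneg⇒∣∣≤ 0≤r , ∣0∣≤0 , +-identityʳ r

  imaginary-⊑ : ∀ {t r} → ∣ t ∣≤ r → (0# +i t) ⊑ r
  imaginary-⊑ {r = r} p = 0# , r , ∣0∣≤0 , p , +-identityˡ r

  ⊑⇒re : ∀ {z r} → z ⊑ r → ∣ re z ∣≤ r
  ⊑⇒re (p , q , (x , x′) , y , d) = ≤-trans x p≤r , ≤-trans x′ p≤r
    where p≤r = 0≤⇒≤ (∣∣≤⇒0≤ y) (trans (solve 2 (λ p q → q := p :+ q :- p) ≈-refl p q) (+-congʳ d))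

  ⊑⇒im : ∀ {z r} → z ⊑ r → ∣ im z ∣≤ r
  ⊑⇒im (p , q , x , (y , y′) , d) = ≤-trans y q≤r , ≤-trans y′ q≤r
    where q≤r = 0≤⇒≤ (∣∣≤⇒0≤ x) (trans (solve 2 (λ p q → p := p :+ q :- q) ≈-refl p q) (+-congʳ d))

  ⊑⇒0≤ : ∀ {z r} → z ⊑ r → 0# ≤ r
  ⊑⇒0≤ p = ∣∣≤⇒0≤ (⊑⇒re p)

  exponential-⊑ : ∀ {z r a α} → ℂ-series.IsExponential z a → IsExponential r α → z ⊑ r → ∀ n → a n ⊑ α n
  exponential-⊑ (p , p′) (q , q′) z⊑r zero = ⊑-cong (ℂR.sym p) (sym q) (real-⊑ (<⇒≤ 0<1))
  exponential-⊑ {z} {r} {a} {α} (p , p′) (q , q′) z⊑r (suc n) = ⊑-cong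
    (ℂR.trans (ℂR.*-congˡ (ℂR.sym (p′ n))) (ℂR.trans (real-* u _) (ℂR.trans (∙-congʳ (ℂ-fromℕ-* (suc n) (a (suc n)))) (1/-cancel n (re (a (suc n))) ,ᶜ 1/-cancel n (im (a (suc n)))))))
    (trans (*-congˡ (sym (q′ n))) (1/-cancel n (α (suc n))))
    (⊑-* (real-⊑ (<⇒≤ (0<1/ (suc n)))) (⊑-* z⊑r (exponential-⊑ (p , p′) (q , q′) z⊑r n)))
    where
    u = 1/ (suc n)
    ∙-congʳ : ∀ {z w} → z ≈ᶜ w → u ∙ᶜ z ≈ᶜ u ∙ᶜ w
    ∙-congʳ (x ,ᶜ y) = *-congˡ x ,ᶜ *-congˡ y

  Σ<-⊑ : ∀ {b β m n} → (∀ k → b k ⊑ β k) → m ℕ.≤′ n →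
         ℂ-series.Σ< b n ℂR.- ℂ-series.Σ< b m ⊑ Σ< β n - Σ< β m
  Σ<-⊑ p ℕ.≤′-refl = ⊑-cong (ℂR.sym (ℂR.-‿inverseʳ _)) (sym (-‿inverseʳ _)) (real-⊑ (≤-refl ≈-refl))
  Σ<-⊑ {b} {β} {m} p (ℕ.≤′-step {n} m≤n) = ⊑-cong
    (rearrange (re (ℂ-series.Σ< b n)) (re (b n)) (re (ℂ-series.Σ< b m)) ,ᶜ rearrange (im (ℂ-series.Σ< b n)) (im (b n)) (im (ℂ-series.Σ< b m)))
    (rearrange (Σ< β n) (β n) (Σ< β m)) (⊑-+ (Σ<-⊑ p m≤n) (p n))
    where
    rearrange : ∀ s t x → s - x + t ≈ s + t - x
    rearrange = solve 3 (λ s t x → s :- x :+ t := s :+ t :- x) ≈-refl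

  -- The condition on `n` and `m` makes the difference of partial sums in `Δ-suc` a genuine sum of
  -- terms of `b`, which the terms of `β` majorise.
  Δ-⊑ : ∀ {a b α β} n {m} → (∀ k → a k ⊑ α k) → (∀ k → b k ⊑ β k) → n ℕ.≤ m →
        ℂ-series.Δ a b n m ⊑ Δ α β n m
  Δ-⊑ {b = b} {β = β} zero {m} p q n≤m = ⊑-cong
    (ℂR.sym (ℂR.trans (ℂR.+-congʳ (ℂR.zeroˡ (ℂ-series.Σ< b m))) (ℂR.-‿inverseʳ 0ᶜ)))
    (solve 1 (λ s → con (+ 0) := con (+ 0) :* s :- con (+ 0)) ≈-refl (Σ< β m)) (real-⊑ (≤-refl ≈-refl))
  Δ-⊑ {a} {b} {α} {β} (suc n) {m} p q n≤m = ⊑-cong (ℂR.sym (ℂ-series.Δ-suc a b n m)) (sym (Δ-suc α β n m))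
    (⊑-+ (⊑-* (p 0) (Σ<-⊑ q (ℕ.≤⇒≤′ n≤m))) (Δ-⊑ n (p ∘ suc) q (ℕ.≤-trans (ℕ.n≤1+n n) n≤m)))

  Σ<-nonneg : ∀ {α} → (∀ n → 0# ≤ α n) → ∀ n → 0# ≤ Σ< α n
  Σ<-nonneg p zero    = ≤-refl ≈-refl
  Σ<-nonneg p (suc n) = +-nonneg (Σ<-nonneg p n) (p n)

  conv-nonneg : ∀ {α β} → (∀ n → 0# ≤ α n) → (∀ n → 0# ≤ β n) → ∀ n → 0# ≤ conv α β n
  conv-nonneg p q zero    = *-nonneg (p 0) (q 0)
  conv-nonneg p q (suc n) = +-nonneg (*-nonneg (p 0) (q (suc n))) (conv-nonneg (p ∘ suc) q n)

  Σ<-monotone : ∀ {β} → (∀ n → 0# ≤ β n) → ∀ k m → Σ< β m ≤ Σ< β (k ℕ.+ m)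
  Σ<-monotone p zero    m = ≤-refl ≈-refl
  Σ<-monotone {β} p (suc k) m = ≤-trans (Σ<-monotone p k m)
    (0≤⇒≤ (p (k ℕ.+ m)) (solve 2 (λ s t → t := s :+ t :- s) ≈-refl (Σ< β (k ℕ.+ m)) (β (k ℕ.+ m))))

  -- Indices below `n` and below `m` add up to less than `n + m`, so each product on the left occurs
  -- among the nonnegative ones on the right.
  Σ<-*-≤ : ∀ {α β} → (∀ n → 0# ≤ α n) → (∀ n → 0# ≤ β n) → ∀ n m →
           Σ< α n * Σ< β m ≤ Σ< (conv α β) (n ℕ.+ m)
  Σ<-*-≤ p q zero m = ≤-cong (sym (CommutativeRing.zeroˡ commutativeRing _)) ≈-refl (Σ<-nonneg (conv-nonneg p q) m)
  Σ<-*-≤ {α} {β} p q (suc n) m = ≤-cong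
    (trans (sym (CommutativeRing.distribʳ commutativeRing _ _ _)) (*-congʳ (sym (Σ<-first α n))))
    (sym (Σ<-conv-suc α β (n ℕ.+ m)))
    (+-mono-≤ (*-monoˡ-≤ (p 0) (Σ<-monotone q (suc n) m)) (Σ<-*-≤ (p ∘ suc) q n m))

  module _ (exp : ℂ → ℂ) (isExp : IsExp exp) where
    re-⟶ : ∀ z → (λ n → re (ℂ-series.Σ< (term z) n)) ⟶ re (exp z)
    re-⟶ z = ⟶-cong (λ n → reflexive (cong re (expPartialSum-≡ z n))) ≈-refl (proj₁ (isExp z))

    im-⟶ : ∀ z → (λ n → im (ℂ-series.Σ< (term z) n)) ⟶ im (exp z)
    im-⟶ z = ⟶-cong (λ n → reflexive (cong im (expPartialSum-≡ z n))) ≈-refl (proj₂ (isExp z))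

    -- Uniqueness identifies `α` with the terms of the real series, whose partial sums of lengths n
    -- and 2n share the limit given by `IsExp`.
    exponential-tail : ∀ {r α} → IsExponential r α → Null (λ n → Σ< α (n ℕ.+ n) - Σ< α n)
    exponential-tail {r} {α} p = null-cong
      (λ n → solve 3 (λ s t x → s :- x :+ :- (t :- x) := s :- t) ≈-refl (Σ< α (n ℕ.+ n)) (Σ< α n) (re (exp (r +i 0#))))
      (null-+ (null-double null) (null-neg null))
      where
      null : Null (λ n → Σ< α n - re (exp (r +i 0#)))
      null = ⟶⇒null (⟶-cong (λ n → trans (reflexive (re-Σ< (term (r +i 0#)) n))
        (Σ<-cong (exponential-unique fromℕ-cancel (realTerm-exponential r) p) n)) ≈-refl (re-⟶ (r +i 0#)))

    -- The defect of the addition theorem is a polynomial with nonnegative coefficients in the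
    -- terms, so it is dominated by the same defect for the majorants exp K and exp L, which in
    -- turn is at most a tail of the convergent series of exp (K + L).
    Δ-bound : ∀ s t → ∃[ τ ] Null τ × (∀ n → ℂ-series.Δ (term (0# +i s)) (term (0# +i t)) n n ⊑ τ n)
    Δ-bound s t =
      let (K , _ , x , x′) = bounded s
          (L , _ , y , y′) = bounded t
          p = exponential-⊑ (term-exponential (0# +i s)) (realTerm-exponential K) (imaginary-⊑ (<⇒≤ x , <⇒≤ x′))
          q = exponential-⊑ (term-exponential (0# +i t)) (realTerm-exponential L) (imaginary-⊑ (<⇒≤ y , <⇒≤ y′))
          τ = Δ (realTerm K) (realTerm L)
      in (λ n → τ n n) ,
         null-squeeze
           (λ n → ∣∣≤-trans (nonneg⇒∣∣≤ (⊑⇒0≤ (Δ-⊑ n p q ℕ.≤-refl)))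
             (+-mono-≤ (Σ<-*-≤ (⊑⇒0≤ ∘ p) (⊑⇒0≤ ∘ q) n n) (≤-refl ≈-refl)))
           (exponential-tail (exponential-conv (realTerm-exponential K) (realTerm-exponential L))) ,
         (λ n → Δ-⊑ n p q ℕ.≤-refl)
      where
      ∣∣≤-trans : ∀ {x r s} → ∣ x ∣≤ r → r ≤ s → ∣ x ∣≤ s
      ∣∣≤-trans (u , v) w = ≤-trans u w , ≤-trans v w

    -- An arbitrary `exp` is not known in advance to respect `_≈_`. Stating the theorem for every
    -- `u` equal to `s + t` builds in the rearrangement of angles.
    exp-+ : ∀ {s t u} → u ≈ s + t → exp (0# +i u) ≈ᶜ exp (0# +i s) *ᶜ exp (0# +i t)
    exp-+ {s} {t} {u} e =
      ⟶-unique (re-⟶ _) (⟶-+ (⟶-* (re-⟶ _) (re-⟶ _)) (⟶-neg (⟶-* (im-⟶ _) (im-⟶ _))))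
        (null-cong (λ n → trans (-‿cong (+-congˡ (-‿cong (re-≈ (product n)))))
            (solve 2 (λ x y → :- (x :- y) := y :- x) ≈-refl (re (A n *ᶜ B n)) (re (C n))))
          (null-neg (null-squeeze (⊑⇒re ∘ proj₂ (proj₂ bound)) (proj₁ (proj₂ bound)))))
      ,ᶜ
      ⟶-unique (im-⟶ _) (⟶-+ (⟶-* (re-⟶ _) (im-⟶ _)) (⟶-* (im-⟶ _) (re-⟶ _)))
        (null-cong (λ n → trans (-‿cong (+-congˡ (-‿cong (im-≈ (product n)))))
            (solve 2 (λ x y → :- (x :- y) := y :- x) ≈-refl (im (A n *ᶜ B n)) (im (C n))))
          (null-neg (null-squeeze (⊑⇒im ∘ proj₂ (proj₂ bound)) (proj₁ (proj₂ bound)))))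
      where
      bound = Δ-bound s t
      A B C : ℕ → ℂ
      A = ℂ-series.Σ< (term (0# +i s))
      B = ℂ-series.Σ< (term (0# +i t))
      C = ℂ-series.Σ< (term (0# +i u))
      product : ∀ n → ℂ-series.Σ< (ℂ-series.conv (term (0# +i s)) (term (0# +i t))) n ≈ᶜ C n
      product = ℂ-series.Σ<-cong (exponential-term (ℂ-series.exponential-cong (+-identityˡ 0# ,ᶜ sym e)
        (ℂ-series.exponential-conv (term-exponential (0# +i s)) (term-exponential (0# +i t)))))

    exp-0 : exp (0# +i 0#) ≈ᶜ 1ᶜ
    exp-0 =
      ⟶-unique (re-⟶ 0ᶜ) (⟶-const 1#) (eventually (λ n → re (ℂ-series.Σ< (term 0ᶜ) n)) (re-≈ ∘ sums)) ,ᶜ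
      ⟶-unique (im-⟶ 0ᶜ) (⟶-const 0#) (eventually (λ n → im (ℂ-series.Σ< (term 0ᶜ) n)) (im-≈ ∘ sums))
      where
      δ : ℕ → ℂ
      δ zero    = 1ᶜ
      δ (suc n) = 0ᶜ
      δ-exponential : ℂ-series.IsExponential 0ᶜ δ
      δ-exponential = ℂR.refl , λ n → ℂR.trans (ℂR.zeroʳ ℂ-integers.⟦ + suc n ⟧) (ℂR.sym (ℂR.zeroˡ (δ n)))
      Σδ : ∀ n → ℂ-series.Σ< δ (suc n) ≈ᶜ 1ᶜ
      Σδ zero    = ℂR.+-identityˡ 1ᶜ
      Σδ (suc n) = ℂR.trans (ℂR.+-identityʳ _) (Σδ n)
      sums : ∀ n → ℂ-series.Σ< (term 0ᶜ) (suc n) ≈ᶜ 1ᶜ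
      sums n = ℂR.trans (ℂR.sym (ℂ-series.Σ<-cong (exponential-term δ-exponential) (suc n))) (Σδ n)
      eventually : ∀ s {x} → (∀ n → s (suc n) ≈ x) → Null (λ n → s n - x)
      -- The partial sum of length 0 is empty, so the constant value is reached from index 1 on.
      eventually s {x} p ε 0<ε = 1 , λ where
        zero    ()
        (suc n) _ → ∣∣<-cong (sym (trans (+-congʳ (p n)) (-‿inverseʳ x))) ≈-refl (proj₂ (null-0 ε 0<ε) n ℕ.z≤n)
      ⟶-const : ∀ x → (λ _ → x) ⟶ x
      ⟶-const x = null⇒⟶ (null-cong (λ _ → sym (-‿inverseʳ x)) null-0)

    -- The conjugated terms satisfy the recurrence for the negated angle, so uniqueness identifies
    -- them with its terms.
    exp-conjugate : ∀ {s t} → s ≈ - t → exp (0# +i s) ≈ᶜ conjugate (exp (0# +i t))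
    exp-conjugate {s} {t} e =
      ⟶-unique (re-⟶ _) (re-⟶ _) (null-cong (λ n → sym (trans (+-congʳ (re-≈ (sums n))) (-‿inverseʳ _))) null-0) ,ᶜ
      ⟶-unique (im-⟶ _) (⟶-neg (im-⟶ _)) (null-cong (λ n → sym (trans (+-congʳ (im-≈ (sums n))) (-‿inverseʳ _))) null-0)
      where
      conjugate-exponential : ℂ-series.IsExponential (0# +i s) (conjugate ∘ term (0# +i t))
      conjugate-exponential =
        let (p , q) = term-exponential (0# +i t)
            a = term (0# +i t)
        in (re-≈ p ,ᶜ trans (-‿cong (im-≈ p)) (solve 0 (:- con (+ 0) := con (+ 0)) ≈-refl)) ,
           λ n → let q′ = ℂR.trans (ℂR.sym (ℂ-fromℕ-* (suc n) (a (suc n)))) (q n) in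
             ℂR.trans (ℂ-fromℕ-* (suc n) (conjugate (a (suc n))))
               (trans (re-≈ q′) (trans
                  (solve 3 (λ t x y → con (+ 0) :* x :- t :* y := con (+ 0) :* x :- (:- t) :* (:- y)) ≈-refl t (re (a n)) (im (a n)))
                  (+-congˡ (-‿cong (*-congʳ (sym e))))) ,ᶜ
                trans (solve 2 (λ k x → k :* (:- x) := :- (k :* x)) ≈-refl (fromℕ (suc n)) (im (a (suc n)))) (trans (-‿cong (im-≈ q′)) (trans
                  (solve 3 (λ t x y → :- (con (+ 0) :* y :+ t :* x) := con (+ 0) :* (:- y) :+ (:- t) :* x) ≈-refl t (re (a n)) (im (a n)))
                  (+-congˡ (*-congʳ (sym e))))))
      conjugate-Σ : ∀ a n → ℂ-series.Σ< (conjugate ∘ a) n ≈ᶜ conjugate (ℂ-series.Σ< a n)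
      conjugate-Σ a zero    = ≈-refl ,ᶜ solve 0 (con (+ 0) := :- con (+ 0)) ≈-refl
      conjugate-Σ a (suc n) = +-congʳ (re-≈ (conjugate-Σ a n)) ,ᶜ
        trans (+-congʳ (im-≈ (conjugate-Σ a n))) (solve 2 (λ x y → :- x :+ :- y := :- (x :+ y)) ≈-refl _ _)
      sums : ∀ n → ℂ-series.Σ< (term (0# +i s)) n ≈ᶜ conjugate (ℂ-series.Σ< (term (0# +i t)) n)
      sums n = ℂR.trans (ℂR.sym (ℂ-series.Σ<-cong (exponential-term conjugate-exponential) n)) (conjugate-Σ (term (0# +i t)) n)

-- Sixth roots of unity

-- (u , v) stands for u + v ω with ω = exp (2πi/6), where ω² = ω - 1 and ω⁻¹ = 1 - ω.
Eisenstein : Set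
Eisenstein = ℤ × ℤ

infixl 6 _⊕_
_⊕_ : Eisenstein → Eisenstein → Eisenstein
(u , v) ⊕ (u′ , v′) = u ℤ.+ u′ , v ℤ.+ v′

one : Eisenstein
one = + 1 , + 0

-- Multiplication by ω: ω (u + v ω) = u ω + v (ω - 1).
ω* : Eisenstein → Eisenstein
ω* (u , v) = ℤ.- v , u ℤ.+ v

conj : Eisenstein → Eisenstein
conj (u , v) = u ℤ.+ v , ℤ.- v

-- The squared modulus of u + v ω, since ω + ω⁻¹ = 1 and ω⁻¹ is the conjugate of ω.
norm : Eisenstein → ℤ
norm (u , v) = u ℤ.* u ℤ.+ u ℤ.* v ℤ.+ v ℤ.* v

ω^ℕ : ℕ → Eisenstein
ω^ℕ zero    = one
ω^ℕ (suc n) = ω* (ω^ℕ n)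

ω^ : ℤ → Eisenstein
ω^ (+ n)    = ω^ℕ n
ω^ -[1+ n ] = conj (ω^ℕ (suc n))

exponent₁ exponent₂ : Index → ℤ
exponent₁ (k , l) = + toℕ k
exponent₂ (k , l) = ℤ.- (+ toℕ k) ℤ.+ + 3 ℤ.* + toℕ l

norm-eigenvalue : ∀ kl → norm (one ⊕ ω^ (exponent₁ kl) ⊕ ω^ (exponent₂ kl)) ≡ eigenvalue kl ℤ.* eigenvalue kl
norm-eigenvalue (k , l) = table k l
  where
  table : ∀ k l → norm (one ⊕ ω^ (exponent₁ (k , l)) ⊕ ω^ (exponent₂ (k , l))) ≡ eigenvalue (k , l) ℤ.* eigenvalue (k , l)
  table = from-yes (Fin.all? λ k → Fin.all? λ l →
    norm (one ⊕ ω^ (exponent₁ (k , l)) ⊕ ω^ (exponent₂ (k , l))) ℤ.≟ eigenvalue (k , l) ℤ.* eigenvalue (k , l))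

module SixthRoots {c ℓ₁ ℓ₂ ℓ₃} (ℝ : RealNumbers c ℓ₁ ℓ₂ ℓ₃)
  (exp : Complex.ℂ ℝ → Complex.ℂ ℝ) (isExp : Complex.IsExp ℝ exp)
  (π : RealNumbers.Carrier ℝ) (isPi : Complex.IsPi ℝ exp π) where
  open RealNumbers ℝ hiding (zero) renaming (refl to ≈-refl)
  open Integers commutativeRing
  open Solver using (solve; _:=_; _:+_; _:*_; :-_; _:-_; con)
  open Complex ℝ
  open ComplexNumbers ℝ
  open Limits ℝ
  open ComplexExponential ℝ
  open import Relation.Binary.Reasoning.Setoid setoid
  private module ℂR = CommutativeRing ℂ-commutativeRing

  e : Carrier → ℂ
  e t = exp (0# +i t)

  -- Passing from `t` to 0 needs an argument because congruence of `exp` is not assumed; the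
  -- addition theorem with `t ≈ 0# + 0#` supplies it.
  e-0 : ∀ {t} → t ≈ 0# → e t ≈ᶜ 1ᶜ
  e-0 p = ℂR.trans (exp-+ exp isExp (trans p (sym (+-identityʳ 0#))))
    (ℂR.trans (ℂR.*-cong (exp-0 exp isExp) (exp-0 exp isExp)) (ℂR.*-identityˡ 1ᶜ))

  unit-modulus : ∀ t → re (e t) * re (e t) + im (e t) * im (e t) ≈ 1#
  unit-modulus t = begin
    x * x + y * y                  ≈⟨ solve 2 (λ x y → x :* x :+ y :* y := x :* x :- y :* (:- y)) ≈-refl x y ⟩
    re (e t *ᶜ conjugate (e t))    ≈⟨ re-≈ (ℂR.*-congˡ (exp-conjugate exp isExp ≈-refl)) ⟨
    re (e t *ᶜ e (- t))            ≈⟨ re-≈ (exp-+ exp isExp (sym (-‿inverseʳ t))) ⟨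
    re (e 0#)                      ≈⟨ re-≈ (exp-0 exp isExp) ⟩
    1#                             ∎
    where
    x = re (e t)
    y = im (e t)

  -- `φ` is the argument π/3 of ω, written as in the statement. `θ` is a third of π/2, the only
  -- angle about which `IsPi` speaks.
  φ θ : Carrier
  φ = fromℕ 2 * π * 1/ 6
  θ = π * 1/ 2 * 1/ 3

  θ+θ+θ : θ + θ + θ ≈ π * 1/ 2
  θ+θ+θ = trans (solve 2 (λ h v → h :* v :+ h :* v :+ h :* v := h :* (con (+ 3) :* v)) ≈-refl (π * 1/ 2) (1/ 3))
    (trans (*-congˡ (1/-inverse 3)) (*-identityʳ _))

  φ≈θ+θ : φ ≈ θ + θ
  φ≈θ+θ = begin
    fromℕ 2 * π * w                                            ≈⟨ *-identityʳ _ ⟨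
    fromℕ 2 * π * w * 1#                                       ≈⟨ *-congˡ (trans (*-cong (1/-inverse 2) (1/-inverse 3)) (*-identityˡ 1#)) ⟨
    fromℕ 2 * π * w * (fromℕ 2 * u * (fromℕ 3 * v))
      ≈⟨ solve 4 (λ p u v w → con (+ 2) :* p :* w :* (con (+ 2) :* u :* (con (+ 3) :* v)) := (p :* u :* v :+ p :* u :* v) :* (con (+ 6) :* w)) ≈-refl π u v w ⟩
    (θ + θ) * (fromℕ 6 * w)                                    ≈⟨ *-congˡ (1/-inverse 6) ⟩
    (θ + θ) * 1#                                               ≈⟨ *-identityʳ _ ⟩
    θ + θ                                                      ∎
    where
    u = 1/ 2
    v = 1/ 3
    w = 1/ 6

  private
    C = re (e θ)
    S = im (e θ)
    a = re (e φ)
    b = im (e φ)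

  e-φ : e φ ≈ᶜ e θ *ᶜ e θ
  e-φ = exp-+ exp isExp φ≈θ+θ

  cos-θ≉0 : ¬ C ≈ 0#
  cos-θ≉0 p = proj₂ (proj₂ isPi) θ 0<θ p
    (0<⇒< (+-pos 0<θ 0<θ) (trans (solve 1 (λ t → t :+ t := t :+ t :+ t :- t) ≈-refl θ) (+-congʳ θ+θ+θ)))
    where
    0<θ : 0# < θ
    0<θ = *-pos (proj₁ isPi) (0<1/ 3)

  -- 0 = cos 3θ = cos θ (4 cos² θ - 3), and π/2 being the first zero of cos excludes cos θ = 0.
  4cos²θ≈3 : ⟦ + 4 ⟧ * (C * C) - ⟦ + 3 ⟧ ≈ 0#
  4cos²θ≈3 = proj₁ (tight y 0#) y¬#0
    where
    y = ⟦ + 4 ⟧ * (C * C) - ⟦ + 3 ⟧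
    e-π/2 : e (π * 1/ 2) ≈ᶜ e θ *ᶜ e θ *ᶜ e θ
    e-π/2 = ℂR.trans (exp-+ exp isExp (sym θ+θ+θ)) (ℂR.*-congʳ (exp-+ exp isExp ≈-refl))
    Cy≈0 : C * y ≈ 0#
    Cy≈0 = begin
      C * y
        -- 4 c³ - 3 c = Re (c + i s)³ + 3 c (c² + s² - 1), where the first summand is cos (π/2) and
        -- the second vanishes on the unit circle.
        ≈⟨ solve 2 (λ c s → c :* (con (+ 4) :* (c :* c) :- con (+ 3)) :=
             (c :* c :- s :* s) :* c :- (c :* s :+ s :* c) :* s :+ con (+ 3) :* c :* (c :* c :+ s :* s :- con (+ 1))) ≈-refl C S ⟩
      re (e θ *ᶜ e θ *ᶜ e θ) + ⟦ + 3 ⟧ * C * (C * C + S * S - ⟦ + 1 ⟧)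
        ≈⟨ +-cong (trans (sym (re-≈ e-π/2)) (proj₁ (proj₂ isPi)))
                  (*-congˡ (trans (+-cong (unit-modulus θ) (-‿cong ⟦⟧-1)) (-‿inverseʳ 1#))) ⟩
      0# + ⟦ + 3 ⟧ * C * 0#
        ≈⟨ solve 1 (λ x → con (+ 0) :+ x :* con (+ 0) := con (+ 0)) ≈-refl (⟦ + 3 ⟧ * C) ⟩
      0# ∎
    y¬#0 : ¬ y # 0#
    y¬#0 y#0 =
      let (z , _ , p) = #⇒invertible y#0 in cos-θ≉0 (begin
      C                     ≈⟨ *-identityʳ C ⟨
      C * 1#                ≈⟨ *-congˡ p ⟨
      C * ((y - 0#) * z)    ≈⟨ solve 3 (λ c y z → c :* ((y :- con (+ 0)) :* z) := c :* y :* z) ≈-refl C y z ⟩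
      C * y * z             ≈⟨ *-congʳ Cy≈0 ⟩
      0# * z                ≈⟨ CommutativeRing.zeroˡ commutativeRing z ⟩
      0#                    ∎)

  -- Together with modulus 1 this says that ω has trace 1 and norm 1, which is the relation ω² = ω -
  -- 1.
  a+a≈1 : a + a ≈ 1#
  a+a≈1 = begin
    a + a
      ≈⟨ +-cong (re-≈ e-φ) (re-≈ e-φ) ⟩
    (C * C - S * S) + (C * C - S * S)
      ≈⟨ solve 3 (λ c s o → (c :* c :- s :* s) :+ (c :* c :- s :* s) :=
           (con (+ 4) :* (c :* c) :- con (+ 3)) :+ con (+ 3) :- (o :+ o) :- con (+ 2) :* (c :* c :+ s :* s :- o)) ≈-refl C S 1# ⟩
    (⟦ + 4 ⟧ * (C * C) - ⟦ + 3 ⟧) + ⟦ + 3 ⟧ - (1# + 1#) - ⟦ + 2 ⟧ * (C * C + S * S - 1#)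
      ≈⟨ +-cong (+-congʳ (+-congʳ 4cos²θ≈3)) (-‿cong (*-congˡ (trans (+-congʳ (unit-modulus θ)) (-‿inverseʳ 1#)))) ⟩
    0# + ⟦ + 3 ⟧ - (1# + 1#) - ⟦ + 2 ⟧ * 0#
      -- The numeral 3 is unfolded into copies of `1#`, so that it can be cancelled against the
      -- variable standing for `1#`.
      ≈⟨ solve 1 (λ o → con (+ 0) :+ (o :+ (o :+ (o :+ con (+ 0)))) :- (o :+ o) :- con (+ 2) :* con (+ 0) := o) ≈-refl 1# ⟩
    1# ∎

  ι : Eisenstein → ℂ
  ι (u , v) = (⟦ u ⟧ + ⟦ v ⟧ * a) +i (⟦ v ⟧ * b)

  ι-⊕ : ∀ x y → ι (x ⊕ y) ≈ᶜ ι x +ᶜ ι y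
  ι-⊕ (u , v) (u′ , v′) =
    trans (+-cong (⟦⟧-+ u u′) (*-congʳ (⟦⟧-+ v v′)))
      (solve 5 (λ u v u′ v′ a → u :+ u′ :+ (v :+ v′) :* a := u :+ v :* a :+ (u′ :+ v′ :* a)) ≈-refl ⟦ u ⟧ ⟦ v ⟧ ⟦ u′ ⟧ ⟦ v′ ⟧ a) ,ᶜ
    trans (*-congʳ (⟦⟧-+ v v′)) (CommutativeRing.distribʳ commutativeRing b ⟦ v ⟧ ⟦ v′ ⟧)

  ι-one : ι one ≈ᶜ 1ᶜ
  ι-one = trans (+-congʳ ⟦⟧-1) (solve 2 (λ o a → o :+ con (+ 0) :* a := o) ≈-refl 1# a) ,ᶜ CommutativeRing.zeroˡ commutativeRing b

  ι-conj : ∀ x → ι (conj x) ≈ᶜ conjugate (ι x)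
  ι-conj (u , v) =
    (begin
      ⟦ u ℤ.+ v ⟧ + ⟦ ℤ.- v ⟧ * a            ≈⟨ +-cong (⟦⟧-+ u v) (*-congʳ (⟦⟧-neg v)) ⟩
      ⟦ u ⟧ + ⟦ v ⟧ + (- ⟦ v ⟧) * a          ≈⟨ +-congʳ (+-congˡ (trans (sym (*-identityʳ ⟦ v ⟧)) (*-congˡ (sym a+a≈1)))) ⟩
      ⟦ u ⟧ + ⟦ v ⟧ * (a + a) + (- ⟦ v ⟧) * a ≈⟨ solve 3 (λ u v a → u :+ v :* (a :+ a) :+ (:- v) :* a := u :+ v :* a) ≈-refl ⟦ u ⟧ ⟦ v ⟧ a ⟩
      ⟦ u ⟧ + ⟦ v ⟧ * a                      ∎) ,ᶜ
    trans (*-congʳ (⟦⟧-neg v)) (solve 2 (λ v b → (:- v) :* b := :- (v :* b)) ≈-refl ⟦ v ⟧ b)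

  ι-ω* : ∀ x → ι (ω* x) ≈ᶜ e φ *ᶜ ι x
  ι-ω* (u , v) = ι-ω*-re ,ᶜ ι-ω*-im
    where
    U = ⟦ u ⟧
    V = ⟦ v ⟧
    ι-ω*-re : ⟦ ℤ.- v ⟧ + ⟦ u ℤ.+ v ⟧ * a ≈ a * (U + V * a) - b * (V * b)
    ι-ω*-re = begin
      ⟦ ℤ.- v ⟧ + ⟦ u ℤ.+ v ⟧ * a                         ≈⟨ +-cong (⟦⟧-neg v) (*-congʳ (⟦⟧-+ u v)) ⟩
      - V + (U + V) * a                                   ≈⟨ solve 3 (λ u v a → :- v :+ (u :+ v) :* a := a :* u :+ v :* a :- v) ≈-refl U V a ⟩
      -- Factors 1 are inserted in order to be replaced by `a + a` and `a * a + b * b`; what remains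
      -- is a polynomial identity, as 2a² - (a² + b²) = a² - b².
      a * U + V * a - V                                   ≈⟨ +-cong (+-congˡ (*-congˡ (*-identityʳ a))) (-‿cong (*-identityʳ V)) ⟨
      a * U + V * (a * 1#) - V * 1#
        ≈⟨ +-cong (+-congˡ (*-congˡ (*-congˡ a+a≈1))) (-‿cong (*-congˡ (unit-modulus φ))) ⟨
      a * U + V * (a * (a + a)) - V * (a * a + b * b)
        ≈⟨ solve 4 (λ u v a b → a :* u :+ v :* (a :* (a :+ a)) :- v :* (a :* a :+ b :* b) := a :* (u :+ v :* a) :- b :* (v :* b)) ≈-refl U V a b ⟩
      a * (U + V * a) - b * (V * b)                       ∎
    ι-ω*-im : ⟦ u ℤ.+ v ⟧ * b ≈ a * (V * b) + b * (U + V * a)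
    ι-ω*-im = begin
      ⟦ u ℤ.+ v ⟧ * b                      ≈⟨ *-congʳ (⟦⟧-+ u v) ⟩
      (U + V) * b                          ≈⟨ *-congʳ (+-congˡ (*-identityʳ V)) ⟨
      (U + V * 1#) * b                     ≈⟨ *-congʳ (+-congˡ (*-congˡ a+a≈1)) ⟨
      (U + V * (a + a)) * b                ≈⟨ solve 4 (λ u v a b → (u :+ v :* (a :+ a)) :* b := a :* (v :* b) :+ b :* (u :+ v :* a)) ≈-refl U V a b ⟩
      a * (V * b) + b * (U + V * a)        ∎

  ι-norm : ∀ x → re (ι x) * re (ι x) + im (ι x) * im (ι x) ≈ ⟦ norm x ⟧
  ι-norm (u , v) = begin
    (U + V * a) * (U + V * a) + V * b * (V * b)
      ≈⟨ solve 4 (λ u v a b → (u :+ v :* a) :* (u :+ v :* a) :+ v :* b :* (v :* b) :=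
           u :* u :+ u :* v :* (a :+ a) :+ v :* v :* (a :* a :+ b :* b)) ≈-refl U V a b ⟩
    U * U + U * V * (a + a) + V * V * (a * a + b * b)
      ≈⟨ +-cong (+-congˡ (trans (*-congˡ a+a≈1) (*-identityʳ _))) (trans (*-congˡ (unit-modulus φ)) (*-identityʳ _)) ⟩
    U * U + U * V + V * V
      ≈⟨ +-cong (trans (⟦⟧-+ (u ℤ.* u) (u ℤ.* v)) (+-cong (⟦⟧-* u u) (⟦⟧-* u v))) (⟦⟧-* v v) ⟨
    ⟦ u ℤ.* u ℤ.+ u ℤ.* v ⟧ + ⟦ v ℤ.* v ⟧
      ≈⟨ ⟦⟧-+ (u ℤ.* u ℤ.+ u ℤ.* v) (v ℤ.* v) ⟨
    ⟦ norm (u , v) ⟧ ∎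
    where
    U = ⟦ u ⟧
    V = ⟦ v ⟧

  exp-ω^ℕ : ∀ n → exp (2πi[ π ] + n / 6) ≈ᶜ ι (ω^ℕ n)
  exp-ω^ℕ zero    = ℂR.trans (e-0 (solve 2 (λ p w → con (+ 2) :* p :* con (+ 0) :* w := con (+ 0)) ≈-refl π (1/ 6))) (ℂR.sym ι-one)
  exp-ω^ℕ (suc n) = ℂR.trans (exp-+ exp isExp angle) (ℂR.trans (ℂR.*-congˡ (exp-ω^ℕ n)) (ℂR.sym (ι-ω* (ω^ℕ n))))
    where
    angle : fromℕ 2 * π * (1# + fromℕ n) * 1/ 6 ≈ φ + fromℕ 2 * π * fromℕ n * 1/ 6
    angle = begin
      fromℕ 2 * π * (1# + fromℕ n) * 1/ 6
        ≈⟨ solve 4 (λ p o n w → con (+ 2) :* p :* (o :+ n) :* w := con (+ 2) :* p :* o :* w :+ con (+ 2) :* p :* n :* w) ≈-refl π 1# (fromℕ n) (1/ 6) ⟩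
      fromℕ 2 * π * 1# * 1/ 6 + fromℕ 2 * π * fromℕ n * 1/ 6
        ≈⟨ +-congʳ (*-congʳ (*-identityʳ _)) ⟩
      φ + fromℕ 2 * π * fromℕ n * 1/ 6 ∎

  exp-ω^ : ∀ m → exp (2πi[ π ] m / 6) ≈ᶜ ι (ω^ m)
  exp-ω^ (+ n)    = exp-ω^ℕ n
  exp-ω^ -[1+ n ] = ℂR.trans
    (exp-conjugate exp isExp (solve 3 (λ p n w → con (+ 2) :* p :* (:- n) :* w := :- (con (+ 2) :* p :* n :* w)) ≈-refl π (fromℕ (suc n)) (1/ 6)))
    (ℂR.trans (re-≈ (exp-ω^ℕ (suc n)) ,ᶜ -‿cong (im-≈ (exp-ω^ℕ (suc n)))) (ℂR.sym (ι-conj (ω^ℕ (suc n)))))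

  modulus² : ∀ m n → let z = 1ᶜ +ᶜ exp (2πi[ π ] m / 6) +ᶜ exp (2πi[ π ] n / 6) in
             re z * re z + im z * im z ≈ ⟦ norm (one ⊕ ω^ m ⊕ ω^ n) ⟧
  modulus² m n = trans (+-cong (*-cong (re-≈ p) (re-≈ p)) (*-cong (im-≈ p) (im-≈ p))) (ι-norm (one ⊕ ω^ m ⊕ ω^ n))
    where
    p : 1ᶜ +ᶜ exp (2πi[ π ] m / 6) +ᶜ exp (2πi[ π ] n / 6) ≈ᶜ ι (one ⊕ ω^ m ⊕ ω^ n)
    p = ℂR.sym (ℂR.trans (ι-⊕ (one ⊕ ω^ m) (ω^ n)) (ℂR.+-cong
      (ℂR.trans (ι-⊕ one (ω^ m)) (ℂR.+-cong ι-one (ℂR.sym (exp-ω^ m)))) (ℂR.sym (exp-ω^ n))))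

-- The spectrum of the Cayley graph in terms of sixth roots of unity

corollary3 : ∀ {c ℓ₁ ℓ₂ ℓ₃} (ℝ : RealNumbers c ℓ₁ ℓ₂ ℓ₃) →
  let open RealNumbers ℝ
      open Complex ℝ
      open Spectrum ℝ
  in
  (∣_∣ : ℂ → Carrier) → IsModulus ∣_∣ →
  (exp : ℂ → ℂ) → IsExp exp →
  (π : Carrier) → IsPi exp π →
  HasSpectrum X₃
    (concatMap
      (λ (k , l) →
        let r = ∣ 1ᶜ
                  +ᶜ exp (2πi[ π ] + toℕ k / 6)
                  +ᶜ exp (2πi[ π ] ℤ.- (+ toℕ k) ℤ.+ + 3 ℤ.* + toℕ l / 6) ∣
        in r ∷ - r ∷ [])
      (cartesianProduct (allFin 6) (allFin 2)))
corollary3 ℝ ∣_∣ isModulus exp isExp π isPi =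
  X₃-spectrum (λ kl → ∣ 1ᶜ +ᶜ exp (2πi[ π ] exponent₁ kl / 6) +ᶜ exp (2πi[ π ] exponent₂ kl / 6) ∣)
    -- The square of each modulus is the norm of an Eisenstein integer, which equals the square of
    -- the tabulated eigenvalue.
    (λ kl → trans (proj₂ (isModulus _))
      (trans (modulus² (exponent₁ kl) (exponent₂ kl)) (reflexive (cong ⟦_⟧ (norm-eigenvalue kl)))))
  where
  open RealNumbers ℝ using (trans; reflexive; commutativeRing)
  open Complex ℝ
  open Integers commutativeRing using (⟦_⟧)
  open CharacteristicPolynomial ℝ using (X₃-spectrum)
  open SixthRoots ℝ exp isExp π isPi using (modulus²)
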